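{- For every integer $k\ge 2$ there exists an integer $M$ such that for every integer $m\ge M$ there are no polynomials $f_1,\dots,f_k\in\mathbb{C}[x]$ such that no $f_i$ is a scalar multiple of $f_j$ for $i\neq j$ and $$f_1(x)^m+\cdots+f_k(x)^m = 0 .$$
   Context: "Scalar multiple" means multiple by an element of $\mathbb{C}$. -}

module Defs where

open import Algebra.Bundles using (RawRing)
import Algebra.Definitions.RawSemiring as RawSemiringDefinitions
open import Data.List.Base using (List; []; _∷_; map)
open import Data.Nat.Base as ℕ using (ℕ; zero; suc; _⊔_)
import Data.Nat.Properties as ℕₚ
open import Data.Product.Base using (∃-syntax; _×_; _,_)
open import Data.Rational.Base as ℚ using (ℚ; 0ℚ; 1ℚ; ½; ∣_∣; 1/_; Positive)
import Data.Rational.Properties as ℚₚ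
open import Data.Rational.Solver using (module +-*-Solver)
open import Level using (Level; 0ℓ) renaming (_⊔_ to _⊔ˡ_)
open import Relation.Binary.PropositionalEquality using (_≡_; refl; sym; trans; cong; cong₂; subst)

-- Real numbers: Cauchy sequences of rationals, with equality given by
-- the difference tending to zero (_≈ℝ_ below).

IsCauchy : (ℕ → ℚ) → Set
IsCauchy x = ∀ ε → 0ℚ ℚ.< ε →
  ∃[ N ] (∀ m n → N ℕ.≤ m → N ℕ.≤ n → ∣ x m ℚ.- x n ∣ ℚ.< ε)

private

  module Identities where

    open +-*-Solver

    split : ∀ p q → p ≡ (p ℚ.- q) ℚ.+ q
    split = solve 2 (λ p q → p := (p :- q) :+ q) refl

    neg-diff : ∀ p q → ℚ.- (p ℚ.- q) ≡ (ℚ.- p) ℚ.- (ℚ.- q)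
    neg-diff = solve 2 (λ p q → :- (p :- q) := (:- p) :- (:- q)) refl

    sum-diff : ∀ p q r s → (p ℚ.+ q) ℚ.- (r ℚ.+ s) ≡ (p ℚ.- r) ℚ.+ (q ℚ.- s)
    sum-diff = solve 4 (λ p q r s → (p :+ q) :- (r :+ s) := (p :- r) :+ (q :- s)) refl

    product-diff : ∀ p q r s →
      p ℚ.* q ℚ.- r ℚ.* s ≡ p ℚ.* (q ℚ.- s) ℚ.+ s ℚ.* (p ℚ.- r)
    product-diff = solve 4 (λ p q r s → p :* q :- r :* s := p :* (q :- s) :+ s :* (p :- r)) refl

  open Identities

  half-pos : ∀ {ε} → 0ℚ ℚ.< ε → 0ℚ ℚ.< ½ ℚ.* ε
  half-pos ε>0 = ℚₚ.*-monoʳ-<-pos ½ ε>0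

  halves : ∀ ε → ½ ℚ.* ε ℚ.+ ½ ℚ.* ε ≡ ε
  halves ε = trans (sym (ℚₚ.*-distribʳ-+ ε ½ ½)) (ℚₚ.*-identityˡ ε)

  shrink : ∀ b → 0ℚ ℚ.< b → ∀ ε → 0ℚ ℚ.< ε →
           ∃[ δ ] (0ℚ ℚ.< δ × b ℚ.* δ ≡ ε)
  shrink b b>0 ε ε>0 = δ , δ>0 , bδ≡ε
    where
    instance
      b-pos : Positive b
      b-pos = ℚ.positive b>0
      b-nonZero : ℚ.NonZero b
      b-nonZero = ℚₚ.pos⇒nonZero b
      1/b-pos : Positive (1/ b)
      1/b-pos = ℚₚ.1/pos⇒pos b
    δ : ℚ
    δ = 1/ b ℚ.* ε
    δ>0 : 0ℚ ℚ.< δ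
    δ>0 = subst (ℚ._< δ) (ℚₚ.*-zeroʳ (1/ b)) (ℚₚ.*-monoʳ-<-pos (1/ b) ε>0)
    bδ≡ε : b ℚ.* δ ≡ ε
    bδ≡ε = trans (sym (ℚₚ.*-assoc b (1/ b) ε))
             (trans (cong (ℚ._* ε) (ℚₚ.*-inverseʳ b)) (ℚₚ.*-identityˡ ε))

  eventuallyBounded : ∀ x → IsCauchy x →
    ∃[ b ] (0ℚ ℚ.< b × ∃[ N ] (∀ n → N ℕ.≤ n → ∣ x n ∣ ℚ.≤ b))
  eventuallyBounded x x-cauchy with x-cauchy 1ℚ (ℚₚ.positive⁻¹ 1ℚ)
  ... | N , close = b , b>0 , N , bound
    where
    b : ℚ
    b = 1ℚ ℚ.+ ∣ x N ∣
    b>0 : 0ℚ ℚ.< b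
    b>0 = ℚₚ.+-mono-<-≤ (ℚₚ.positive⁻¹ 1ℚ) (ℚₚ.0≤∣p∣ (x N))
    bound : ∀ n → N ℕ.≤ n → ∣ x n ∣ ℚ.≤ b
    bound n N≤n = begin
      ∣ x n ∣                      ≡⟨ cong ∣_∣ (split (x n) (x N)) ⟩
      ∣ (x n ℚ.- x N) ℚ.+ x N ∣    ≤⟨ ℚₚ.∣p+q∣≤∣p∣+∣q∣ (x n ℚ.- x N) (x N) ⟩
      ∣ x n ℚ.- x N ∣ ℚ.+ ∣ x N ∣  ≤⟨ ℚₚ.+-monoˡ-≤ ∣ x N ∣ (ℚₚ.<⇒≤ (close n N N≤n ℕₚ.≤-refl)) ⟩
      b                            ∎
      where
      open ℚₚ.≤-Reasoning

  ∣p*q∣<aθ : ∀ p q a θ → 0ℚ ℚ.< a → ∣ p ∣ ℚ.≤ a → ∣ q ∣ ℚ.< θ →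
             ∣ p ℚ.* q ∣ ℚ.< a ℚ.* θ
  ∣p*q∣<aθ p q a θ a>0 ∣p∣≤a ∣q∣<θ = begin-strict
    ∣ p ℚ.* q ∣      ≡⟨ ℚₚ.∣p*q∣≡∣p∣*∣q∣ p q ⟩
    ∣ p ∣ ℚ.* ∣ q ∣  ≤⟨ ℚₚ.*-monoʳ-≤-nonNeg ∣ q ∣ {{ℚ.nonNegative (ℚₚ.0≤∣p∣ q)}} ∣p∣≤a ⟩
    a ℚ.* ∣ q ∣      <⟨ ℚₚ.*-monoʳ-<-pos a {{ℚ.positive a>0}} ∣q∣<θ ⟩
    a ℚ.* θ          ∎
    where
    open ℚₚ.≤-Reasoning

  product-close : ∀ p q r s b δ c η ε → 0ℚ ℚ.< b → 0ℚ ℚ.< c →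
    ∣ p ∣ ℚ.≤ b → ∣ s ∣ ℚ.≤ c → ∣ q ℚ.- s ∣ ℚ.< δ → ∣ p ℚ.- r ∣ ℚ.< η →
    b ℚ.* δ ≡ ½ ℚ.* ε → c ℚ.* η ≡ ½ ℚ.* ε →
    ∣ p ℚ.* q ℚ.- r ℚ.* s ∣ ℚ.< ε
  product-close p q r s b δ c η ε b>0 c>0 ∣p∣≤b ∣s∣≤c ∣q-s∣<δ ∣p-r∣<η bδ≡ cη≡ = begin-strict
    ∣ p ℚ.* q ℚ.- r ℚ.* s ∣
      ≡⟨ cong ∣_∣ (product-diff p q r s) ⟩
    ∣ p ℚ.* (q ℚ.- s) ℚ.+ s ℚ.* (p ℚ.- r) ∣
      ≤⟨ ℚₚ.∣p+q∣≤∣p∣+∣q∣ (p ℚ.* (q ℚ.- s)) (s ℚ.* (p ℚ.- r)) ⟩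
    ∣ p ℚ.* (q ℚ.- s) ∣ ℚ.+ ∣ s ℚ.* (p ℚ.- r) ∣
      <⟨ ℚₚ.+-mono-< (∣p*q∣<aθ p (q ℚ.- s) b δ b>0 ∣p∣≤b ∣q-s∣<δ)
                     (∣p*q∣<aθ s (p ℚ.- r) c η c>0 ∣s∣≤c ∣p-r∣<η) ⟩
    b ℚ.* δ ℚ.+ c ℚ.* η
      ≡⟨ cong₂ ℚ._+_ bδ≡ cη≡ ⟩
    ½ ℚ.* ε ℚ.+ ½ ℚ.* ε
      ≡⟨ halves ε ⟩
    ε ∎
    where
    open ℚₚ.≤-Reasoning

abstract

  const-cauchy : ∀ q → IsCauchy (λ _ → q)
  const-cauchy q ε ε>0 =
    0 , λ _ _ _ _ → subst (ℚ._< ε) (sym (cong ∣_∣ (ℚₚ.+-inverseʳ q))) ε>0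

  +-cauchy : ∀ x y → IsCauchy x → IsCauchy y → IsCauchy (λ n → x n ℚ.+ y n)
  +-cauchy x y x-cauchy y-cauchy ε ε>0
    with x-cauchy (½ ℚ.* ε) (half-pos ε>0) | y-cauchy (½ ℚ.* ε) (half-pos ε>0)
  ... | N₁ , close₁ | N₂ , close₂ = N₁ ⊔ N₂ , close
    where
    close : ∀ m n → N₁ ⊔ N₂ ℕ.≤ m → N₁ ⊔ N₂ ℕ.≤ n →
            ∣ (x m ℚ.+ y m) ℚ.- (x n ℚ.+ y n) ∣ ℚ.< ε
    close m n N≤m N≤n = begin-strict
      ∣ (x m ℚ.+ y m) ℚ.- (x n ℚ.+ y n) ∣
        ≡⟨ cong ∣_∣ (sum-diff (x m) (y m) (x n) (y n)) ⟩
      ∣ (x m ℚ.- x n) ℚ.+ (y m ℚ.- y n) ∣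
        ≤⟨ ℚₚ.∣p+q∣≤∣p∣+∣q∣ (x m ℚ.- x n) (y m ℚ.- y n) ⟩
      ∣ x m ℚ.- x n ∣ ℚ.+ ∣ y m ℚ.- y n ∣
        <⟨ ℚₚ.+-mono-<
             (close₁ m n (ℕₚ.m⊔n≤o⇒m≤o N₁ N₂ N≤m) (ℕₚ.m⊔n≤o⇒m≤o N₁ N₂ N≤n))
             (close₂ m n (ℕₚ.m⊔n≤o⇒n≤o N₁ N₂ N≤m) (ℕₚ.m⊔n≤o⇒n≤o N₁ N₂ N≤n)) ⟩
      ½ ℚ.* ε ℚ.+ ½ ℚ.* ε
        ≡⟨ halves ε ⟩
      ε ∎
      where
      open ℚₚ.≤-Reasoning

  neg-cauchy : ∀ x → IsCauchy x → IsCauchy (λ n → ℚ.- x n)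
  neg-cauchy x x-cauchy ε ε>0 with x-cauchy ε ε>0
  ... | N , close = N , λ m n N≤m N≤n → subst (ℚ._< ε) (eq m n) (close m n N≤m N≤n)
    where
    eq : ∀ m n → ∣ x m ℚ.- x n ∣ ≡ ∣ (ℚ.- x m) ℚ.- (ℚ.- x n) ∣
    eq m n = trans (sym (ℚₚ.∣-p∣≡∣p∣ (x m ℚ.- x n)))
      (cong ∣_∣ (neg-diff (x m) (x n)))

  *-cauchy : ∀ x y → IsCauchy x → IsCauchy y → IsCauchy (λ n → x n ℚ.* y n)
  *-cauchy x y x-cauchy y-cauchy ε ε>0 =
    step (eventuallyBounded x x-cauchy) (eventuallyBounded y y-cauchy)
    where
    Goal : Set
    Goal = ∃[ N ] (∀ m n → N ℕ.≤ m → N ℕ.≤ n → ∣ x m ℚ.* y m ℚ.- x n ℚ.* y n ∣ ℚ.< ε)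

    combine : ∀ {b c δ η} → 0ℚ ℚ.< b → 0ℚ ℚ.< c → b ℚ.* δ ≡ ½ ℚ.* ε → c ℚ.* η ≡ ½ ℚ.* ε →
      ∃[ N ] (∀ n → N ℕ.≤ n → ∣ x n ∣ ℚ.≤ b) →
      ∃[ N ] (∀ n → N ℕ.≤ n → ∣ y n ∣ ℚ.≤ c) →
      ∃[ N ] (∀ m n → N ℕ.≤ m → N ℕ.≤ n → ∣ y m ℚ.- y n ∣ ℚ.< δ) →
      ∃[ N ] (∀ m n → N ℕ.≤ m → N ℕ.≤ n → ∣ x m ℚ.- x n ∣ ℚ.< η) → Goal
    combine {b} {c} {δ} {η} b>0 c>0 bδ≡ cη≡
      (N₁ , bound₁) (N₂ , bound₂) (N₃ , close₃) (N₄ , close₄) =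
      (N₁ ⊔ N₂) ⊔ (N₃ ⊔ N₄) , close
      where
      close : ∀ m n → (N₁ ⊔ N₂) ⊔ (N₃ ⊔ N₄) ℕ.≤ m → (N₁ ⊔ N₂) ⊔ (N₃ ⊔ N₄) ℕ.≤ n →
              ∣ x m ℚ.* y m ℚ.- x n ℚ.* y n ∣ ℚ.< ε
      close m n N≤m N≤n =
        product-close (x m) (y m) (x n) (y n) b δ c η ε b>0 c>0
          (bound₁ m (ℕₚ.m⊔n≤o⇒m≤o N₁ N₂ N₁₂≤m)) (bound₂ n (ℕₚ.m⊔n≤o⇒n≤o N₁ N₂ N₁₂≤n))
          (close₃ m n (ℕₚ.m⊔n≤o⇒m≤o N₃ N₄ N₃₄≤m) (ℕₚ.m⊔n≤o⇒m≤o N₃ N₄ N₃₄≤n))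
          (close₄ m n (ℕₚ.m⊔n≤o⇒n≤o N₃ N₄ N₃₄≤m) (ℕₚ.m⊔n≤o⇒n≤o N₃ N₄ N₃₄≤n))
          bδ≡ cη≡
        where
        N₁₂≤m : N₁ ⊔ N₂ ℕ.≤ m
        N₁₂≤m = ℕₚ.m⊔n≤o⇒m≤o (N₁ ⊔ N₂) (N₃ ⊔ N₄) N≤m
        N₁₂≤n : N₁ ⊔ N₂ ℕ.≤ n
        N₁₂≤n = ℕₚ.m⊔n≤o⇒m≤o (N₁ ⊔ N₂) (N₃ ⊔ N₄) N≤n
        N₃₄≤m : N₃ ⊔ N₄ ℕ.≤ m
        N₃₄≤m = ℕₚ.m⊔n≤o⇒n≤o (N₁ ⊔ N₂) (N₃ ⊔ N₄) N≤m
        N₃₄≤n : N₃ ⊔ N₄ ℕ.≤ n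
        N₃₄≤n = ℕₚ.m⊔n≤o⇒n≤o (N₁ ⊔ N₂) (N₃ ⊔ N₄) N≤n

    step : ∃[ b ] (0ℚ ℚ.< b × ∃[ N ] (∀ n → N ℕ.≤ n → ∣ x n ∣ ℚ.≤ b)) →
           ∃[ c ] (0ℚ ℚ.< c × ∃[ N ] (∀ n → N ℕ.≤ n → ∣ y n ∣ ℚ.≤ c)) → Goal
    step (b , b>0 , x-bound) (c , c>0 , y-bound) =
      choose (shrink b b>0 (½ ℚ.* ε) (half-pos ε>0)) (shrink c c>0 (½ ℚ.* ε) (half-pos ε>0))
      where
      choose : ∃[ δ ] (0ℚ ℚ.< δ × b ℚ.* δ ≡ ½ ℚ.* ε) →
               ∃[ η ] (0ℚ ℚ.< η × c ℚ.* η ≡ ½ ℚ.* ε) → Goal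
      choose (δ , δ>0 , bδ≡) (η , η>0 , cη≡) =
        combine b>0 c>0 bδ≡ cη≡ x-bound y-bound (y-cauchy δ δ>0) (x-cauchy η η>0)

record ℝ : Set where
  constructor mkℝ
  field
    seq    : ℕ → ℚ
    cauchy : IsCauchy seq

open ℝ public

infix 4 _≈ℝ_
_≈ℝ_ : ℝ → ℝ → Set
x ≈ℝ y = ∀ ε → 0ℚ ℚ.< ε →
  ∃[ N ] (∀ n → N ℕ.≤ n → ∣ seq x n ℚ.- seq y n ∣ ℚ.< ε)

infixl 6 _+ℝ_ _-ℝ_
infixl 7 _*ℝ_
infix  8 -ℝ_

_+ℝ_ : ℝ → ℝ → ℝ
x +ℝ y = mkℝ (λ n → seq x n ℚ.+ seq y n) (+-cauchy (seq x) (seq y) (cauchy x) (cauchy y))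

_*ℝ_ : ℝ → ℝ → ℝ
x *ℝ y = mkℝ (λ n → seq x n ℚ.* seq y n) (*-cauchy (seq x) (seq y) (cauchy x) (cauchy y))

-ℝ_ : ℝ → ℝ
-ℝ x = mkℝ (λ n → ℚ.- seq x n) (neg-cauchy (seq x) (cauchy x))

_-ℝ_ : ℝ → ℝ → ℝ
x -ℝ y = x +ℝ (-ℝ y)

fromℚ : ℚ → ℝ
fromℚ q = mkℝ (λ _ → q) (const-cauchy q)

infix 5 _+i_
record ℂ : Set where
  constructor _+i_
  field
    re : ℝ
    im : ℝ

open ℂ public

ℂ-rawRing : RawRing 0ℓ 0ℓ
ℂ-rawRing = record
  { Carrier = ℂ
  ; _≈_     = λ z w → re z ≈ℝ re w × im z ≈ℝ im w
  ; _+_     = λ z w → (re z +ℝ re w) +i (im z +ℝ im w)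
  ; _*_     = λ z w → (re z *ℝ re w -ℝ im z *ℝ im w) +i (re z *ℝ im w +ℝ im z *ℝ re w)
  ; -_      = λ z → (-ℝ re z) +i (-ℝ im z)
  ; 0#      = fromℚ 0ℚ +i fromℚ 0ℚ
  ; 1#      = fromℚ 1ℚ +i fromℚ 0ℚ
  }

-- Univariate polynomials over R.  The list  a₀ ∷ a₁ ∷ … ∷ aₙ ∷ []
-- stands for  a₀ + a₁ x + … + aₙ xⁿ.  Trailing zero coefficients are
-- allowed, so polynomials are compared coefficient by coefficient.

module Polynomial {c ℓ : Level} (R : RawRing c ℓ) where

  open RawRing R

  Poly : Set c
  Poly = List Carrier

  coeff : Poly → ℕ → Carrier
  coeff []      _       = 0#
  coeff (a ∷ p) zero    = a
  coeff (a ∷ p) (suc n) = coeff p n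

  infix 4 _≈ₚ_
  _≈ₚ_ : Poly → Poly → Set ℓ
  p ≈ₚ q = ∀ n → coeff p n ≈ coeff q n

  infixl 6 _+ₚ_
  _+ₚ_ : Poly → Poly → Poly
  []      +ₚ q       = q
  (a ∷ p) +ₚ []      = a ∷ p
  (a ∷ p) +ₚ (b ∷ q) = (a + b) ∷ (p +ₚ q)

  infixl 7 _·ₚ_ _*ₚ_
  _·ₚ_ : Carrier → Poly → Poly
  a ·ₚ p = map (a *_) p

  -- (a + x p) q = a q + x (p q)
  _*ₚ_ : Poly → Poly → Poly
  []      *ₚ q = []
  (a ∷ p) *ₚ q = (a ·ₚ q) +ₚ (0# ∷ (p *ₚ q))

  rawRing : RawRing c ℓ
  rawRing = record
    { Carrier = Poly
    ; _≈_     = _≈ₚ_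
    ; _+_     = _+ₚ_
    ; _*_     = _*ₚ_
    ; -_      = map (-_)
    ; 0#      = []
    ; 1#      = 1# ∷ []
    }

  open RawSemiringDefinitions (RawRing.rawSemiring rawRing) public using (_^_; sum)

  0ₚ : Poly
  0ₚ = []

  IsScalarMultipleOf : Poly → Poly → Set (c ⊔ˡ ℓ)
  IsScalarMultipleOf p q = ∃[ a ] (p ≈ₚ a ·ₚ q)

open Polynomial ℂ-rawRing public using (_≈ₚ_; _^_; sum; 0ₚ; IsScalarMultipleOf)

ℂ[x] : Set
ℂ[x] = Polynomial.Poly ℂ-rawRing

{-# OPTIONS --safe #-}
module Submission where

-- Dividing by a common factor, one may assume that the f_i generate the unit ideal, and by
-- induction on k that every relation Σ a_i f_i^m = 0 with constant coefficients has only nonzero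
-- coefficients. Put y_i = a_i f_i^m and n = m − k, and let D be the largest degree. For a
-- derivation θ and j < k one has θ^j y_i = f_i^n A_ji with deg A_ji ≤ k D, so the vector (f_i^n)
-- lies in the kernel of the matrix A. A vector relation between the derivatives of the y_i yields
-- a relation with constant coefficients and no larger support; hence, by the induction hypothesis,
-- this kernel is one-dimensional. Elimination produces a kernel vector C ≠ 0 whose degree is
-- bounded by a multiple of D that depends on k only, and f_i^n C_j = f_j^n C_i. As the f_i^n
-- generate the unit ideal, f_j^n divides C_j ≠ 0, so n is bounded in terms of k unless D = 0,
-- when the f_i are proportional constants.

open import Defs using (module Polynomial)
open import Algebra.Bundles using (CommutativeRing; RawRing)
import Algebra.Definitions.RawMonoid as RawMonoidDefinitions
import Algebra.Properties.CommutativeMonoid.Mult as CommutativeMonoidMult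
import Algebra.Properties.CommutativeSemigroup as CommutativeSemigroupProperties
import Algebra.Properties.CommutativeSemiring.Exp as CommutativeSemiringExp
import Algebra.Properties.Group as GroupProperties
import Algebra.Properties.Ring as RingProperties
import Algebra.Properties.Semiring.Exp as SemiringExp
import Algebra.Properties.Semiring.Mult as SemiringMult
import Algebra.Properties.Semiring.Sum as SemiringSum
import Algebra.Solver.Ring.NaturalCoefficients.Default as SemiringSolver
open import Data.Empty using (⊥; ⊥-elim)
open import Data.Fin.Base using (Fin; zero; suc; toℕ; fromℕ<; punchIn; punchOut)
import Data.Fin.Properties as Finₚ
open import Data.List.Base using ([]; _∷_; map; length)
open import Data.Nat.Base as ℕ using (ℕ; zero; suc; _≤_; _<_; z≤n; s≤s)
import Data.Nat.Properties as ℕₚ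
open import Data.Product.Base using (Σ-syntax; ∃-syntax; _×_; _,_; proj₁; proj₂)
open import Data.Rational.Base as ℚ using (ℚ; 0ℚ; 1ℚ; ½; ∣_∣; 1/_)
import Data.Rational.Properties as ℚₚ
open import Data.Rational.Solver using (module +-*-Solver)
open import Data.Sum.Base using (_⊎_; inj₁; inj₂)
import Data.Vec.Functional as Vector
open import Level using (0ℓ; _⊔_)
open import Relation.Binary.Bundles using (Setoid)
open import Relation.Binary.PropositionalEquality as ≡ using (_≡_; _≢_)
import Relation.Binary.Reasoning.Setoid as SetoidReasoning
open import Relation.Nullary.Decidable using (Dec; yes; no; ¬¬-excluded-middle)
open import Relation.Nullary.Negation using (¬_; contradiction; ¬¬-map; negated-stable)

-- Vanishing of a complex number cannot be decided, but equality is stable and the theorem is a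
-- negation, so all case distinctions on vanishing are made under a double negation. The vector of
-- the powers already lies in the kernel, but its degree grows with the exponent, while the degrees
-- of the entries of the matrix are bounded independently of it; the contradiction comes from
-- comparing it with a second, small kernel vector. One-dimensionality is used in the form: a kernel
-- vector with a zero coordinate vanishes. To read a kernel vector as a relation between the
-- derivatives, its coordinates must be divided by the different powers. This changes the vector but
-- not the places of its zeros, and only those matter. As many derivatives as polynomials are taken
-- because each differentiation that removes an unknown also uses up one of the relations. The
-- coefficients must be arbitrary constants from the outset: those extracted from a vector relation
-- are not under control.

-- Double negation

¬¬-bind : ∀ {a b} {A : Set a} {B : Set b} → ¬ ¬ A → (A → ¬ ¬ B) → ¬ ¬ B
¬¬-bind ¬¬a f = negated-stable (¬¬-map f ¬¬a)

¬∀⇒¬¬∃¬ : ∀ {a p} {A : Set a} {P : A → Set p} → (∀ {x} → ¬ ¬ P x → P x) →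
          ¬ (∀ x → P x) → ¬ ¬ (∃[ x ] ¬ P x)
¬∀⇒¬¬∃¬ stable ¬∀ ¬∃ = ¬∀ λ x → stable λ ¬Px → ¬∃ (x , ¬Px)

-- Double negation shift, available here because the index set is finite. It collects choices that
-- exist only under a double negation into one function.
¬¬-Fin : ∀ {p} {k} {P : Fin k → Set p} → (∀ i → ¬ ¬ P i) → ¬ ¬ (∀ i → P i)
¬¬-Fin {k = zero}  ¬¬P ¬∀ = ¬∀ λ ()
¬¬-Fin {k = suc k} ¬¬P ¬∀ = ¬¬P zero λ P0 → ¬¬-Fin (λ i → ¬¬P (suc i)) λ P+ →
  ¬∀ λ { zero → P0 ; (suc i) → P+ i }

-- Ideals and powers of comaximal families

module Comaximality {c ℓ} (R : CommutativeRing c ℓ) where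
  open CommutativeRing R hiding (zero)
  open SemiringExp semiring using (_^_; ^-congˡ)
  open CommutativeSemiringExp commutativeSemiring using (^-distrib-*)
  open SemiringSolver commutativeSemiring using (solve; _:=_; _:+_; _:*_)

  -- Membership is a derivation rather than a tuple of coefficients, so a property closed under
  -- sums, multiples and equality passes from the generators to the ideal by recursion.
  data Ideal {k} (f : Fin k → Carrier) : Carrier → Set (c ⊔ ℓ) where
    gen  : ∀ i → Ideal f (f i)
    add  : ∀ {x y} → Ideal f x → Ideal f y → Ideal f (x + y)
    mul  : ∀ r {x} → Ideal f x → Ideal f (r * x)
    resp : ∀ {x y} → x ≈ y → Ideal f x → Ideal f y

  -- Replaces the binomial theorem: radicals of ideals are closed under addition.
  ideal-*-^ : ∀ {k} {u : Fin k → Carrier} {x y} m n {z} →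
              Ideal u (z * x ^ m) → Ideal u (z * y ^ n) → Ideal u (z * (x + y) ^ (m ℕ.+ n))
  ideal-*-^ zero n {z} zx zy =
    resp (trans (*-comm _ _) (*-congʳ (*-identityʳ z))) (mul _ zx)
  ideal-*-^ (suc m) zero {z} zx zy =
    resp (trans (*-comm _ _) (*-congʳ (*-identityʳ z))) (mul _ zy)
  -- One factor `x + y` is split off and its two summands are absorbed into `z`, which lowers `m` or
  -- `n`; the extra factor `z` exists for this purpose.
  ideal-*-^ {u = u} {x} {y} (suc m) (suc n) {z} zx zy = resp
    (solve 4 (λ x y z s → (z :* x) :* s :+ (z :* y) :* s := z :* ((x :+ y) :* s)) refl
      x y z ((x + y) ^ (m ℕ.+ suc n)))
    (add
      (ideal-*-^ m (suc n) (resp (sym (*-assoc z x _)) zx)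
        (resp (trans (sym (*-assoc x z _)) (*-congʳ (*-comm x z))) (mul x zy)))
      (≡.subst (λ l → Ideal u ((z * y) * (x + y) ^ l)) (≡.sym (ℕₚ.+-suc m n))
        (ideal-*-^ (suc m) n (resp (trans (sym (*-assoc y z _)) (*-congʳ (*-comm y z))) (mul y zx))
          (resp (sym (*-assoc z y _)) zy))))

  ideal-radical : ∀ {k l} {f : Fin k → Carrier} {u : Fin l → Carrier} →
                  (∀ i → ∃[ n ] Ideal u (f i ^ n)) →
                  ∀ {x} → Ideal f x → ∃[ n ] Ideal u (x ^ n)
  ideal-radical gens (gen i) = gens i
  ideal-radical gens (add x∈ y∈) with ideal-radical gens x∈ | ideal-radical gens y∈
  ... | m , xᵐ∈ | n , yⁿ∈ = m ℕ.+ n , resp (*-identityˡ _)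
    (ideal-*-^ m n (resp (sym (*-identityˡ _)) xᵐ∈) (resp (sym (*-identityˡ _)) yⁿ∈))
  ideal-radical gens (mul r {x} x∈) with ideal-radical gens x∈
  ... | n , xⁿ∈ = n , resp (sym (^-distrib-* r x n)) (mul (r ^ n) xⁿ∈)
  ideal-radical gens (resp x≈y x∈) with ideal-radical gens x∈
  ... | n , xⁿ∈ = n , resp (^-congˡ n x≈y) xⁿ∈

  1^n≈1 : ∀ n → 1# ^ n ≈ 1#
  1^n≈1 zero    = refl
  1^n≈1 (suc n) = trans (*-identityˡ _) (1^n≈1 n)

  -- Every `f i` is in the radical of the ideal of the powers, hence so is 1, and every power of 1
  -- is 1.
  comaximal-^ : ∀ {k} {f : Fin k → Carrier} n → Ideal f 1# → Ideal (λ i → f i ^ n) 1#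
  comaximal-^ n 1∈ with ideal-radical (λ i → n , gen i) 1∈
  ... | m , 1ᵐ∈ = resp (1^n≈1 m) 1ᵐ∈

record StableDomain {c ℓ} (R : CommutativeRing c ℓ) : Set (c ⊔ ℓ) where
  open CommutativeRing R
  field
    stable : ∀ {x y} → ¬ ¬ (x ≈ y) → x ≈ y
    cancel : ∀ {x y} → ¬ (x ≈ 0#) → x * y ≈ 0# → y ≈ 0#
    1≉0    : ¬ (1# ≈ 0#)

-- Linear algebra over a domain with stable equality

module Domain {c ℓ} (R : CommutativeRing c ℓ) (domain : StableDomain R) where
  open CommutativeRing R hiding (zero)
  open StableDomain domain
  open SemiringSum semiring using (sum; sum-cong-≋; sum-replicate-zero; ∑-distrib-+; *-distribˡ-sum) public
  open SemiringExp semiring using (_^_) public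
  open RingProperties ring using (-‿distribˡ-*; -‿distribʳ-*)
  open GroupProperties +-group using (x≈y⇒x∙y⁻¹≈ε; x∙y⁻¹≈ε⇒x≈y; identityʳ-unique; inverseʳ-unique)
  open SemiringSolver commutativeSemiring using (solve; _:=_; _:+_; _:*_)
  open SetoidReasoning setoid

  *-≉0 : ∀ {x y} → ¬ (x ≈ 0#) → ¬ (y ≈ 0#) → ¬ (x * y ≈ 0#)
  *-≉0 x≉0 y≉0 xy≈0 = y≉0 (cancel x≉0 xy≈0)

  ^-≉0 : ∀ {x} n → ¬ (x ≈ 0#) → ¬ (x ^ n ≈ 0#)
  ^-≉0 zero    x≉0 = 1≉0
  ^-≉0 (suc n) x≉0 = *-≉0 x≉0 (^-≉0 n x≉0)

  x-yz≈0⇒x≈yz : ∀ {x y z} → x + (- y) * z ≈ 0# → x ≈ y * z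
  x-yz≈0⇒x≈yz x-yz≈0 = x∙y⁻¹≈ε⇒x≈y _ _ (trans (+-congˡ (-‿distribˡ-* _ _)) x-yz≈0)

  x≈yz⇒x-yz≈0 : ∀ {x y z} → x ≈ y * z → x + (- y) * z ≈ 0#
  x≈yz⇒x-yz≈0 x≈yz = trans (+-congˡ (sym (-‿distribˡ-* _ _))) (x≈y⇒x∙y⁻¹≈ε x≈yz)

  *-cancelˡ : ∀ {x y z} → ¬ (x ≈ 0#) → x * y ≈ x * z → y ≈ z
  *-cancelˡ {x} {y} {z} x≉0 xy≈xz = x∙y⁻¹≈ε⇒x≈y _ _ (cancel x≉0 (begin
    x * (y + - z)         ≈⟨ distribˡ x y (- z) ⟩
    x * y + x * (- z)     ≈⟨ +-congˡ (-‿distribʳ-* x z) ⟨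
    x * y + - (x * z)     ≈⟨ x≈y⇒x∙y⁻¹≈ε xy≈xz ⟩
    0#                    ∎))

  sum-≈0 : ∀ {k} {t : Fin k → Carrier} → (∀ i → t i ≈ 0#) → sum t ≈ 0#
  sum-≈0 {k} t≈0 = trans (sum-cong-≋ t≈0) (sum-replicate-zero k)

  sum-linear : ∀ {k} x y (a b w : Fin k → Carrier) →
    sum (λ i → (x * a i + y * b i) * w i) ≈ x * sum (λ i → a i * w i) + y * sum (λ i → b i * w i)
  sum-linear x y a b w = begin
    sum (λ i → (x * a i + y * b i) * w i)
      ≈⟨ sum-cong-≋ (λ i → solve 5 (λ x y a b w → (x :* a :+ y :* b) :* w := x :* (a :* w) :+ y :* (b :* w))
           refl x y (a i) (b i) (w i)) ⟩
    sum (λ i → x * (a i * w i) + y * (b i * w i))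
      ≈⟨ ∑-distrib-+ (λ i → x * (a i * w i)) _ ⟩
    sum (λ i → x * (a i * w i)) + sum (λ i → y * (b i * w i))
      ≈⟨ +-cong (*-distribˡ-sum x (λ i → a i * w i)) (*-distribˡ-sum y (λ i → b i * w i)) ⟨
    x * sum (λ i → a i * w i) + y * sum (λ i → b i * w i) ∎

  -- A substitute for division: `U` is the product of all entries and `E i` the product of the
  -- others, so that `E i` stands for `U / u i`.
  complements : ∀ {k} (u : Fin k → Carrier) → (∀ i → ¬ (u i ≈ 0#)) →
    ∃[ U ] Σ[ E ∈ (Fin k → Carrier) ] (∀ i → E i * u i ≈ U) × ¬ (U ≈ 0#)
  complements {zero}  u u≉0 = 1# , (λ ()) , (λ ()) , 1≉0
  complements {suc k} u u≉0 with complements (λ i → u (suc i)) (λ i → u≉0 (suc i))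
  ... | U , E , Eu≈U , U≉0 = u zero * U , U Vector.∷ (λ i → u zero * E i) ,
    (λ { zero → *-comm U (u zero) ; (suc i) → trans (*-assoc _ _ _) (*-congˡ (Eu≈U i)) }) ,
    *-≉0 (u≉0 zero) U≉0

  -- Kernel vectors of small degree

  module SmallKernel {p} (Deg≤ : ℕ → Carrier → Set p)
    (deg-mono : ∀ {d e x} → d ≤ e → Deg≤ d x → Deg≤ e x)
    (deg-0 : Deg≤ 0 0#) (deg-1 : Deg≤ 0 1#)
    (deg-+ : ∀ {d x y} → Deg≤ d x → Deg≤ d y → Deg≤ d (x + y))
    (deg-neg : ∀ {d x} → Deg≤ d x → Deg≤ d (- x))
    (deg-* : ∀ {d e x y} → Deg≤ d x → Deg≤ e y → Deg≤ (d ℕ.+ e) (x * y))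
    where

    deg-sum : ∀ {k d} {t : Fin k → Carrier} → (∀ i → Deg≤ d (t i)) → Deg≤ d (sum t)
    deg-sum {zero}  t≤ = deg-mono z≤n deg-0
    deg-sum {suc k} t≤ = deg-+ (t≤ zero) (deg-sum (λ i → t≤ (suc i)))

    -- The recursion follows the elimination: the new entries are 2 by 2 minors, which doubles `B`,
    -- and going back multiplies the shorter solution by an entry of the old matrix, which adds `B`.
    kernelBound : ℕ → ℕ → ℕ
    kernelBound zero    B = B
    kernelBound (suc k) B = B ℕ.+ kernelBound k (B ℕ.+ B)

    -- Rows range over an arbitrary type because elimination keeps them all; the pivot row just
    -- becomes zero. Starting from a given kernel vector replaces any count of ranks.
    KernelVector : ∀ {a} {X : Set a} {k} → (X → Fin k → Carrier) → (Fin k → Carrier) → Set (a ⊔ ℓ)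
    KernelVector A v = (∀ x → sum (λ i → A x i * v i) ≈ 0#) × ¬ (∀ i → v i ≈ 0#)

    -- Fraction-free Gaussian elimination of the first column.
    smallKernelVector : ∀ {a} {X : Set a} {k B} (A : X → Fin k → Carrier) {v} → KernelVector A v →
      (∀ x i → Deg≤ B (A x i)) →
      ¬ ¬ (Σ[ w ∈ (Fin k → Carrier) ] KernelVector A w × (∀ i → Deg≤ (kernelBound k B) (w i)))
    smallKernelVector {k = zero}      A (_ , v≉0) A≤ _ = v≉0 λ ()
    smallKernelVector {X = X} {suc k} {B} A {v} (Av≈0 , v≉0) A≤ =
      ¬¬-bind ¬¬-excluded-middle λ
        { (yes A₀≈0) → λ ¬w → ¬w (unit A₀≈0)
        ; (no A₀≉0) → ¬¬-bind (¬∀⇒¬¬∃¬ stable A₀≉0) λ (r , p≉0) →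
            ¬¬-map (lift r p≉0)
              (smallKernelVector (eliminate r) (eliminate-kernel r , tail≉0 r p≉0) (eliminate-deg r))
        }
      where
      Small : Set _
      Small = Σ[ w ∈ (Fin (suc k) → Carrier) ] KernelVector A w × (∀ i → Deg≤ (kernelBound (suc k) B) (w i))

      unit : (∀ x → A x zero ≈ 0#) → Small
      unit A₀≈0 = 1# Vector.∷ (λ _ → 0#) ,
        ((λ x → trans
          (+-cong (trans (*-identityʳ _) (A₀≈0 x)) (sum-≈0 {t = λ i → A x (suc i) * 0#} (λ i → zeroʳ _))) (+-identityˡ 0#)) ,
         (λ w≈0 → 1≉0 (w≈0 zero))) ,
        (λ { zero → deg-mono z≤n deg-1 ; (suc i) → deg-mono z≤n deg-0 })

      eliminate : X → X → Fin k → Carrier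
      eliminate r x i = A r zero * A x (suc i) + (- A x zero) * A r (suc i)

      eliminate-deg : ∀ r x i → Deg≤ (B ℕ.+ B) (eliminate r x i)
      eliminate-deg r x i = deg-+ (deg-* (A≤ r zero) (A≤ x (suc i))) (deg-* (deg-neg (A≤ x zero)) (A≤ r (suc i)))

      row : X → (Fin k → Carrier) → Carrier
      row x w = sum (λ i → A x (suc i) * w i)

      eliminate-row : ∀ r x w → sum (λ i → eliminate r x i * w i) ≈ A r zero * row x w + (- A x zero) * row r w
      eliminate-row r x w = sum-linear (A r zero) (- A x zero) (λ i → A x (suc i)) (λ i → A r (suc i)) w

      v₊ : Fin k → Carrier
      v₊ i = v (suc i)

      row-v₊ : ∀ x → row x v₊ ≈ (- A x zero) * v zero
      row-v₊ x = trans (inverseʳ-unique _ _ (Av≈0 x)) (-‿distribˡ-* _ _)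

      eliminate-kernel : ∀ r x → sum (λ i → eliminate r x i * v₊ i) ≈ 0#
      eliminate-kernel r x = begin
        sum (λ i → eliminate r x i * v₊ i)                           ≈⟨ eliminate-row r x v₊ ⟩
        A r zero * row x v₊ + (- A x zero) * row r v₊                ≈⟨ +-congʳ (*-congˡ (row-v₊ x)) ⟩
        A r zero * ((- A x zero) * v zero) + (- A x zero) * row r v₊
          ≈⟨ solve 4 (λ p q s t → p :* (q :* s) :+ q :* t := q :* (p :* s :+ t)) refl
               (A r zero) (- A x zero) (v zero) (row r v₊) ⟩
        (- A x zero) * (A r zero * v zero + row r v₊)                ≈⟨ *-congˡ (Av≈0 r) ⟩
        (- A x zero) * 0#                                            ≈⟨ zeroʳ _ ⟩
        0#                                                           ∎

      tail≉0 : ∀ r → ¬ (A r zero ≈ 0#) → ¬ (∀ i → v₊ i ≈ 0#)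
      tail≉0 r p≉0 v₊≈0 = v≉0 λ { zero → cancel p≉0 p*v₀≈0 ; (suc i) → v₊≈0 i }
        where
        p*v₀≈0 : A r zero * v zero ≈ 0#
        p*v₀≈0 = begin
          A r zero * v zero                ≈⟨ +-identityʳ _ ⟨
          A r zero * v zero + 0#
            ≈⟨ +-congˡ (sum-≈0 {t = λ i → A r (suc i) * v₊ i} (λ i → trans (*-congˡ (v₊≈0 i)) (zeroʳ _))) ⟨
          A r zero * v zero + row r v₊     ≈⟨ Av≈0 r ⟩
          0#                               ∎

      lift : ∀ r → ¬ (A r zero ≈ 0#) →
        Σ[ w ∈ (Fin k → Carrier) ] KernelVector (eliminate r) w × (∀ i → Deg≤ (kernelBound k (B ℕ.+ B)) (w i)) → Small
      -- The first coordinate solves the pivot row; scaling the others by the pivot avoids dividing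
      -- by it.
      lift r p≉0 (w , (w-kernel , w≉0) , w≤) = (- row r w) Vector.∷ (λ i → A r zero * w i) ,
        (kernel , λ Cw≈0 → w≉0 (λ i → cancel p≉0 (Cw≈0 (suc i)))) ,
        λ { zero → deg-neg (deg-sum (λ i → deg-* (A≤ r (suc i)) (w≤ i)))
          ; (suc i) → deg-* (A≤ r zero) (w≤ i) }
        where
        kernel : ∀ x → A x zero * (- row r w) + sum (λ i → A x (suc i) * (A r zero * w i)) ≈ 0#
        kernel x = begin
          A x zero * (- row r w) + sum (λ i → A x (suc i) * (A r zero * w i))
            ≈⟨ +-cong (trans (sym (-‿distribʳ-* _ _)) (-‿distribˡ-* _ _))
                 (sum-cong-≋ (λ i → solve 3 (λ a p w → a :* (p :* w) := p :* (a :* w)) refl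
                    (A x (suc i)) (A r zero) (w i))) ⟩
          (- A x zero) * row r w + sum (λ i → A r zero * (A x (suc i) * w i))
            ≈⟨ +-congˡ (*-distribˡ-sum (A r zero) (λ i → A x (suc i) * w i)) ⟨
          (- A x zero) * row r w + A r zero * row x w
            ≈⟨ +-comm _ _ ⟩
          A r zero * row x w + (- A x zero) * row r w
            ≈⟨ eliminate-row r x w ⟨
          sum (λ i → eliminate r x i * w i)
            ≈⟨ w-kernel x ⟩
          0# ∎

  -- Derivations: from relations between derivatives to constant relations

  module Differential
    (θ : Carrier → Carrier)
    (θ-cong : ∀ {x y} → x ≈ y → θ x ≈ θ y)
    (θ-+ : ∀ x y → θ (x + y) ≈ θ x + θ y)
    (θ-* : ∀ x y → θ (x * y) ≈ θ x * y + x * θ y)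
    (proportional : ∀ {x y} → ¬ (y ≈ 0#) → y * θ x ≈ θ y * x → ¬ ¬ (∃[ a ] (θ a ≈ 0# × x ≈ a * y)))
    where

    θ-0 : θ 0# ≈ 0#
    θ-0 = identityʳ-unique (θ 0#) (θ 0#) (trans (sym (θ-+ 0# 0#)) (θ-cong (+-identityˡ 0#)))

    θ-1 : θ 1# ≈ 0#
    θ-1 = identityʳ-unique (θ 1#) (θ 1#) (begin
      θ 1# + θ 1#              ≈⟨ +-cong (*-identityʳ _) (*-identityˡ _) ⟨
      θ 1# * 1# + 1# * θ 1#    ≈⟨ θ-* 1# 1# ⟨
      θ (1# * 1#)              ≈⟨ θ-cong (*-identityˡ 1#) ⟩
      θ 1#                     ∎)

    θ-sum : ∀ {k} (t : Fin k → Carrier) → θ (sum t) ≈ sum (λ i → θ (t i))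
    θ-sum {zero}  t = θ-0
    θ-sum {suc k} t = trans (θ-+ _ _) (+-congˡ (θ-sum (λ i → t (suc i))))

    θ-≈0 : ∀ {x} → x ≈ 0# → θ x ≈ 0#
    θ-≈0 x≈0 = trans (θ-cong x≈0) θ-0

    θ^ : ℕ → Carrier → Carrier
    θ^ zero    x = x
    θ^ (suc j) x = θ (θ^ j x)

    θ^-sum : ∀ {k} j (t : Fin k → Carrier) → θ^ j (sum t) ≈ sum (λ i → θ^ j (t i))
    θ^-sum zero    t = refl
    θ^-sum (suc j) t = trans (θ-cong (θ^-sum j t)) (θ-sum (λ i → θ^ j (t i)))

    θ^-≈0 : ∀ j {x} → x ≈ 0# → θ^ j x ≈ 0#
    θ^-≈0 zero    x≈0 = x≈0
    θ^-≈0 (suc j) x≈0 = θ-≈0 (θ^-≈0 j x≈0)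

    -- The factor `q` is n + 1 times `θ x`; leaving it abstract keeps integer multiples out of the
    -- degree estimates.
    θ-^-suc : ∀ {x q} n → θ (x ^ suc n) ≈ x ^ n * q → θ (x ^ suc (suc n)) ≈ x ^ suc n * (θ x + q)
    θ-^-suc {x} {q} n θxⁿ⁺¹≈ = begin
      θ (x * x ^ suc n)                            ≈⟨ θ-* x (x ^ suc n) ⟩
      θ x * x ^ suc n + x * θ (x ^ suc n)          ≈⟨ +-congˡ (*-congˡ θxⁿ⁺¹≈) ⟩
      θ x * (x * x ^ n) + x * (x ^ n * q)
        ≈⟨ solve 4 (λ θx x s q → θx :* (x :* s) :+ x :* (s :* q) := (x :* s) :* (θx :+ q)) refl (θ x) x (x ^ n) q ⟩
      x ^ suc n * (θ x + q)                        ∎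

    θ-^-* : ∀ {x q} n y → θ (x ^ suc n) ≈ x ^ n * q → θ (x ^ suc n * y) ≈ x ^ n * (q * y + x * θ y)
    θ-^-* {x} {q} n y θxⁿ⁺¹≈ = begin
      θ (x ^ suc n * y)                            ≈⟨ θ-* (x ^ suc n) y ⟩
      θ (x ^ suc n) * y + x ^ suc n * θ y          ≈⟨ +-congʳ (*-congʳ θxⁿ⁺¹≈) ⟩
      (x ^ n * q) * y + (x * x ^ n) * θ y
        ≈⟨ solve 5 (λ s q y x θy → (s :* q) :* y :+ (x :* s) :* θy := s :* (q :* y :+ x :* θy)) refl
             (x ^ n) q y x (θ y) ⟩
      x ^ n * (q * y + x * θ y)                    ∎

    -- Constants are the elements killed by `θ`. The clause comparing `e` with `v` carries zeros of
    -- `v` over to `e`, which is what makes the relation accessible to an induction on the number of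
    -- terms.
    ConstantRelation : ∀ {k} → (y v : Fin k → Carrier) → Set (c ⊔ ℓ)
    ConstantRelation {k} y v = Σ[ e ∈ (Fin k → Carrier) ]
      (∀ i → θ (e i) ≈ 0#) × (∀ i → v i ≈ 0# → e i ≈ 0#) ×
      ¬ (∀ i → e i ≈ 0#) × sum (λ i → e i * y i) ≈ 0#

    constantRelation-∷ : ∀ {k} {y v : Fin (suc k) → Carrier} {w} →
      (∀ i → v (suc i) ≈ 0# → w i ≈ 0#) →
      ConstantRelation (λ i → y (suc i)) w → ConstantRelation y v
    constantRelation-∷ v≈0⇒w≈0 (e , θe≈0 , support , e≉0 , relation) = 0# Vector.∷ e ,
      (λ { zero → θ-0 ; (suc i) → θe≈0 i }) ,
      (λ { zero _ → refl ; (suc i) v≈0 → support i (v≈0⇒w≈0 i v≈0) }) ,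
      (λ e≈0 → e≉0 λ i → e≈0 (suc i)) ,
      trans (+-cong (zeroˡ _) relation) (+-identityˡ 0#)

    -- A relation satisfied by y and its derivatives is differentiated and combined with itself
    -- so as to cancel its first coefficient; when this gives the zero relation, the coefficients
    -- are constant multiples of the first one.
    constantRelation : ∀ k (y v : Fin k → Carrier) →
      (∀ j → j < k → sum (λ i → v i * θ^ j (y i)) ≈ 0#) → ¬ (∀ i → v i ≈ 0#) →
      ¬ ¬ ConstantRelation y v
    constantRelation zero    y v relations v≉0 _ = v≉0 λ ()
    constantRelation (suc k) y v relations v≉0 = ¬¬-bind ¬¬-excluded-middle λ
      { (yes v₀≈0) → ¬¬-map (constantRelation-∷ {y = y} (λ i v≈0 → v≈0))
          (constantRelation k y₊ v₊
            (λ j j<k → trans (sym (+-identityˡ _))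
              (trans (+-congʳ (sym (trans (*-congʳ v₀≈0) (zeroˡ _)))) (relations j (ℕₚ.m<n⇒m<1+n j<k))))
            (λ v₊≈0 → v≉0 λ { zero → v₀≈0 ; (suc i) → v₊≈0 i }))
      ; (no v₀≉0) → ¬¬-bind ¬¬-excluded-middle λ
          { (yes w≈0) → ¬¬-map (multiples v₀≉0)
              (¬¬-Fin λ i → proportional v₀≉0 (x-yz≈0⇒x≈yz (w≈0 i)))
          ; (no w≉0) → ¬¬-map (constantRelation-∷ {y = y} w-support)
              (constantRelation k y₊ (λ i → w (suc i)) w-relations w≉0)
          }
      }
      where
      y₊ v₊ : Fin k → Carrier
      y₊ i = y (suc i)
      v₊ i = v (suc i)

      -- The numerator of the derivative of `v i / v zero`: zero at the first index, and zero
      -- throughout just when all these quotients are constant.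
      w : Fin (suc k) → Carrier
      w i = v zero * θ (v i) + (- θ (v zero)) * v i

      w-support : ∀ i → v₊ i ≈ 0# → w (suc i) ≈ 0#
      w-support i v≈0 = trans
        (+-cong (trans (*-congˡ (θ-≈0 v≈0)) (zeroʳ _)) (trans (*-congˡ v≈0) (zeroʳ _))) (+-identityˡ 0#)

      -- Differentiating relation `j` also produces relation `suc j`, which must be subtracted;
      -- hence one relation is lost together with one unknown.
      θv-relation : ∀ j → j < k → sum (λ i → θ (v i) * θ^ j (y i)) ≈ 0#
      θv-relation j j<k = begin
        sum (λ i → θ (v i) * θ^ j (y i))
          ≈⟨ +-identityʳ _ ⟨
        sum (λ i → θ (v i) * θ^ j (y i)) + 0#
          ≈⟨ +-congˡ (relations (suc j) (s≤s j<k)) ⟨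
        sum (λ i → θ (v i) * θ^ j (y i)) + sum (λ i → v i * θ^ (suc j) (y i))
          ≈⟨ ∑-distrib-+ (λ i → θ (v i) * θ^ j (y i)) (λ i → v i * θ^ (suc j) (y i)) ⟨
        sum (λ i → θ (v i) * θ^ j (y i) + v i * θ^ (suc j) (y i))
          ≈⟨ sum-cong-≋ (λ i → θ-* (v i) (θ^ j (y i))) ⟨
        sum (λ i → θ (v i * θ^ j (y i)))
          ≈⟨ θ-sum (λ i → v i * θ^ j (y i)) ⟨
        θ (sum (λ i → v i * θ^ j (y i)))
          ≈⟨ θ-≈0 (relations j (ℕₚ.m<n⇒m<1+n j<k)) ⟩
        0# ∎

      w-relations : ∀ j → j < k → sum (λ i → w (suc i) * θ^ j (y₊ i)) ≈ 0#
      w-relations j j<k = begin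
        sum (λ i → w (suc i) * θ^ j (y₊ i))
          ≈⟨ +-identityˡ _ ⟨
        0# + sum (λ i → w (suc i) * θ^ j (y₊ i))
          ≈⟨ +-congʳ (trans (*-congʳ (x≈yz⇒x-yz≈0 (*-comm _ _))) (zeroˡ (θ^ j (y zero)))) ⟨
        sum (λ i → w i * θ^ j (y i))
          ≈⟨ sum-linear (v zero) (- θ (v zero)) (λ i → θ (v i)) v (λ i → θ^ j (y i)) ⟩
        v zero * sum (λ i → θ (v i) * θ^ j (y i)) + (- θ (v zero)) * sum (λ i → v i * θ^ j (y i))
          ≈⟨ +-cong (*-congˡ (θv-relation j j<k)) (*-congˡ (relations j (ℕₚ.m<n⇒m<1+n j<k))) ⟩
        v zero * 0# + (- θ (v zero)) * 0#
          ≈⟨ +-cong (zeroʳ _) (zeroʳ _) ⟩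
        0# + 0#
          ≈⟨ +-identityˡ 0# ⟩
        0# ∎

      multiples : ¬ (v zero ≈ 0#) → (∀ i → ∃[ a ] (θ a ≈ 0# × v₊ i ≈ a * v zero)) → ConstantRelation y v
      multiples v₀≉0 multiple = e ,
        (λ { zero → θ-1 ; (suc i) → proj₁ (proj₂ (multiple i)) }) ,
        (λ i v≈0 → cancel v₀≉0 (trans (trans (*-comm _ _) (sym (v≈e*v₀ i))) v≈0)) ,
        (λ e≈0 → 1≉0 (e≈0 zero)) ,
        cancel v₀≉0 (begin
          v zero * sum (λ i → e i * y i)       ≈⟨ *-distribˡ-sum (v zero) (λ i → e i * y i) ⟩
          sum (λ i → v zero * (e i * y i))     ≈⟨ sum-cong-≋ (λ i → trans (sym (*-assoc _ _ (y i)))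
                                                     (*-congʳ (trans (*-comm _ _) (sym (v≈e*v₀ i))))) ⟩
          sum (λ i → v i * y i)                ≈⟨ relations 0 (s≤s z≤n) ⟩
          0#                                   ∎)
        where
        e : Fin (suc k) → Carrier
        e = 1# Vector.∷ (λ i → proj₁ (multiple i))
        v≈e*v₀ : ∀ i → v i ≈ e i * v zero
        v≈e*v₀ zero    = sym (*-identityˡ _)
        v≈e*v₀ (suc i) = proj₂ (proj₂ (multiple i))

-- Polynomials over a commutative ring

module PolynomialRing {c ℓ} (K : CommutativeRing c ℓ) where
  open CommutativeRing K hiding (zero)
  open Polynomial rawRing using (Poly; coeff; _+ₚ_; _·ₚ_; _*ₚ_)
  open SemiringMult semiring using (×-congʳ; ×-comm-*) renaming (_×_ to _×ᴷ_)
  open CommutativeMonoidMult +-commutativeMonoid using (×-distrib-+)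
  open RingProperties ring using (-0#≈0#)
  open CommutativeSemigroupProperties +-commutativeSemigroup using (interchange)

  infix 4 _≋_
  -- Wrapped in a record so that `p` and `q` can be inferred from the type, which the bare family of
  -- coefficient equations does not allow.
  record _≋_ (p q : Poly) : Set ℓ where
    constructor coeffs-≈
    field coeff-≈ : ∀ n → coeff p n ≈ coeff q n

  open _≋_ public

  ≋-refl : ∀ {p} → p ≋ p
  ≋-refl = coeffs-≈ λ _ → refl

  ≋-sym : ∀ {p q} → p ≋ q → q ≋ p
  ≋-sym (coeffs-≈ p≈q) = coeffs-≈ λ n → sym (p≈q n)

  ≋-trans : ∀ {p q r} → p ≋ q → q ≋ r → p ≋ r
  ≋-trans (coeffs-≈ p≈q) (coeffs-≈ q≈r) = coeffs-≈ λ n → trans (p≈q n) (q≈r n)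

  ≋-setoid : Setoid c ℓ
  ≋-setoid = record
    { Carrier = Poly
    ; _≈_ = _≋_
    ; isEquivalence = record { refl = ≋-refl ; sym = ≋-sym ; trans = ≋-trans }
    }

  -ₚ_ : Poly → Poly
  -ₚ_ = map (-_)

  coeff-+ : ∀ p q n → coeff (p +ₚ q) n ≈ coeff p n + coeff q n
  coeff-+ []      q       n       = sym (+-identityˡ (coeff q n))
  coeff-+ (a ∷ p) []      n       = sym (+-identityʳ (coeff (a ∷ p) n))
  coeff-+ (a ∷ p) (b ∷ q) zero    = refl
  coeff-+ (a ∷ p) (b ∷ q) (suc n) = coeff-+ p q n

  coeff-· : ∀ a p n → coeff (a ·ₚ p) n ≈ a * coeff p n
  coeff-· a []      n       = sym (zeroʳ a)
  coeff-· a (b ∷ p) zero    = refl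
  coeff-· a (b ∷ p) (suc n) = coeff-· a p n

  coeff-neg : ∀ p n → coeff (-ₚ p) n ≈ - coeff p n
  coeff-neg []      n       = sym -0#≈0#
  coeff-neg (a ∷ p) zero    = refl
  coeff-neg (a ∷ p) (suc n) = coeff-neg p n

  ∷-cong : ∀ {a b p q} → a ≈ b → p ≋ q → a ∷ p ≋ b ∷ q
  ∷-cong a≈b (coeffs-≈ p≈q) = coeffs-≈ λ { zero → a≈b ; (suc n) → p≈q n }

  shift-cong : ∀ {p q} → p ≋ q → 0# ∷ p ≋ 0# ∷ q
  shift-cong = ∷-cong refl

  shift-[] : 0# ∷ [] ≋ []
  shift-[] = coeffs-≈ λ { zero → refl ; (suc n) → refl }

  +ₚ-cong : ∀ {p p′ q q′} → p ≋ p′ → q ≋ q′ → p +ₚ q ≋ p′ +ₚ q′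
  +ₚ-cong {p} {p′} {q} {q′} (coeffs-≈ p≈) (coeffs-≈ q≈) = coeffs-≈ λ n →
    trans (coeff-+ p q n) (trans (+-cong (p≈ n) (q≈ n)) (sym (coeff-+ p′ q′ n)))

  +ₚ-assoc : ∀ p q r → (p +ₚ q) +ₚ r ≋ p +ₚ (q +ₚ r)
  +ₚ-assoc p q r = coeffs-≈ λ n → begin
    coeff ((p +ₚ q) +ₚ r) n                ≈⟨ coeff-+ (p +ₚ q) r n ⟩
    coeff (p +ₚ q) n + coeff r n           ≈⟨ +-congʳ (coeff-+ p q n) ⟩
    coeff p n + coeff q n + coeff r n      ≈⟨ +-assoc _ _ _ ⟩
    coeff p n + (coeff q n + coeff r n)    ≈⟨ +-congˡ (coeff-+ q r n) ⟨
    coeff p n + coeff (q +ₚ r) n           ≈⟨ coeff-+ p (q +ₚ r) n ⟨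
    coeff (p +ₚ (q +ₚ r)) n                ∎
    where open SetoidReasoning setoid

  +ₚ-comm : ∀ p q → p +ₚ q ≋ q +ₚ p
  +ₚ-comm p q = coeffs-≈ λ n → trans (coeff-+ p q n) (trans (+-comm _ _) (sym (coeff-+ q p n)))

  +ₚ-identityʳ : ∀ p → p +ₚ [] ≋ p
  +ₚ-identityʳ p = +ₚ-comm p []

  +ₚ-inverseʳ : ∀ p → p +ₚ (-ₚ p) ≋ []
  +ₚ-inverseʳ p = coeffs-≈ λ n →
    trans (coeff-+ p (-ₚ p) n) (trans (+-congˡ (coeff-neg p n)) (-‿inverseʳ (coeff p n)))

  -ₚ-cong : ∀ {p q} → p ≋ q → -ₚ p ≋ -ₚ q
  -ₚ-cong {p} {q} (coeffs-≈ p≈q) = coeffs-≈ λ n →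
    trans (coeff-neg p n) (trans (-‿cong (p≈q n)) (sym (coeff-neg q n)))

  +ₚ-interchange : ∀ p q r s → (p +ₚ q) +ₚ (r +ₚ s) ≋ (p +ₚ r) +ₚ (q +ₚ s)
  +ₚ-interchange p q r s = coeffs-≈ λ n → begin
    coeff ((p +ₚ q) +ₚ (r +ₚ s)) n                           ≈⟨ coeff-+₄ p q r s n ⟩
    (coeff p n + coeff q n) + (coeff r n + coeff s n)        ≈⟨ interchange _ _ _ _ ⟩
    (coeff p n + coeff r n) + (coeff q n + coeff s n)        ≈⟨ coeff-+₄ p r q s n ⟨
    coeff ((p +ₚ r) +ₚ (q +ₚ s)) n                           ∎
    where
    open SetoidReasoning setoid
    coeff-+₄ : ∀ p q r s n →
      coeff ((p +ₚ q) +ₚ (r +ₚ s)) n ≈ (coeff p n + coeff q n) + (coeff r n + coeff s n)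
    coeff-+₄ p q r s n = trans (coeff-+ (p +ₚ q) (r +ₚ s) n) (+-cong (coeff-+ p q n) (coeff-+ r s n))

  shift-+ : ∀ p q → 0# ∷ (p +ₚ q) ≋ (0# ∷ p) +ₚ (0# ∷ q)
  shift-+ p q = ∷-cong (sym (+-identityˡ 0#)) ≋-refl

  ·-cong : ∀ {a b p q} → a ≈ b → p ≋ q → a ·ₚ p ≋ b ·ₚ q
  ·-cong {a} {b} {p} {q} a≈b (coeffs-≈ p≈q) = coeffs-≈ λ n →
    trans (coeff-· a p n) (trans (*-cong a≈b (p≈q n)) (sym (coeff-· b q n)))

  ·-distribˡ-+ : ∀ a p q → a ·ₚ (p +ₚ q) ≋ a ·ₚ p +ₚ a ·ₚ q
  ·-distribˡ-+ a p q = coeffs-≈ λ n → begin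
    coeff (a ·ₚ (p +ₚ q)) n                ≈⟨ coeff-· a (p +ₚ q) n ⟩
    a * coeff (p +ₚ q) n                   ≈⟨ *-congˡ (coeff-+ p q n) ⟩
    a * (coeff p n + coeff q n)            ≈⟨ distribˡ a _ _ ⟩
    a * coeff p n + a * coeff q n          ≈⟨ +-cong (coeff-· a p n) (coeff-· a q n) ⟨
    coeff (a ·ₚ p) n + coeff (a ·ₚ q) n    ≈⟨ coeff-+ (a ·ₚ p) (a ·ₚ q) n ⟨
    coeff (a ·ₚ p +ₚ a ·ₚ q) n             ∎
    where open SetoidReasoning setoid

  ·-assoc : ∀ a b p → (a * b) ·ₚ p ≋ a ·ₚ (b ·ₚ p)
  ·-assoc a b p = coeffs-≈ λ n → begin
    coeff ((a * b) ·ₚ p) n     ≈⟨ coeff-· (a * b) p n ⟩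
    a * b * coeff p n          ≈⟨ *-assoc a b _ ⟩
    a * (b * coeff p n)        ≈⟨ *-congˡ (coeff-· b p n) ⟨
    a * coeff (b ·ₚ p) n       ≈⟨ coeff-· a (b ·ₚ p) n ⟨
    coeff (a ·ₚ (b ·ₚ p)) n    ∎
    where open SetoidReasoning setoid

  ·-identityˡ : ∀ p → 1# ·ₚ p ≋ p
  ·-identityˡ p = coeffs-≈ λ n → trans (coeff-· 1# p n) (*-identityˡ _)

  ·-zeroˡ : ∀ p → 0# ·ₚ p ≋ []
  ·-zeroˡ p = coeffs-≈ λ n → trans (coeff-· 0# p n) (zeroˡ _)

  ·-shift : ∀ a p → a ·ₚ (0# ∷ p) ≋ 0# ∷ (a ·ₚ p)
  ·-shift a p = ∷-cong (zeroʳ a) ≋-refl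

  module _ where
    open SetoidReasoning ≋-setoid

    *ₚ-congˡ : ∀ p {q q′} → q ≋ q′ → p *ₚ q ≋ p *ₚ q′
    *ₚ-congˡ []      q≋q′ = ≋-refl
    *ₚ-congˡ (a ∷ p) q≋q′ = +ₚ-cong (·-cong refl q≋q′) (shift-cong (*ₚ-congˡ p q≋q′))

    *ₚ-zeroʳ : ∀ p → p *ₚ [] ≋ []
    *ₚ-zeroʳ []      = ≋-refl
    *ₚ-zeroʳ (a ∷ p) = ≋-trans (shift-cong (*ₚ-zeroʳ p)) shift-[]

    -- Multiplication recurses on its left factor. This is the mirror recursion on the right factor,
    -- from which commutativity follows.
    *ₚ-∷ : ∀ p b q → p *ₚ (b ∷ q) ≋ b ·ₚ p +ₚ (0# ∷ p *ₚ q)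
    *ₚ-∷ []      b q = ≋-sym shift-[]
    *ₚ-∷ (a ∷ p) b q = ∷-cong (+-congʳ (*-comm a b)) (begin
      a ·ₚ q +ₚ p *ₚ (b ∷ q)                  ≈⟨ +ₚ-cong ≋-refl (*ₚ-∷ p b q) ⟩
      a ·ₚ q +ₚ (b ·ₚ p +ₚ (0# ∷ p *ₚ q))     ≈⟨ +ₚ-assoc (a ·ₚ q) (b ·ₚ p) _ ⟨
      (a ·ₚ q +ₚ b ·ₚ p) +ₚ (0# ∷ p *ₚ q)     ≈⟨ +ₚ-cong (+ₚ-comm (a ·ₚ q) (b ·ₚ p)) ≋-refl ⟩
      (b ·ₚ p +ₚ a ·ₚ q) +ₚ (0# ∷ p *ₚ q)     ≈⟨ +ₚ-assoc (b ·ₚ p) _ _ ⟩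
      b ·ₚ p +ₚ (a ·ₚ q +ₚ (0# ∷ p *ₚ q))     ∎)

    *ₚ-comm : ∀ p q → p *ₚ q ≋ q *ₚ p
    *ₚ-comm []      q = ≋-sym (*ₚ-zeroʳ q)
    *ₚ-comm (a ∷ p) q = begin
      a ·ₚ q +ₚ (0# ∷ p *ₚ q)    ≈⟨ +ₚ-cong ≋-refl (shift-cong (*ₚ-comm p q)) ⟩
      a ·ₚ q +ₚ (0# ∷ q *ₚ p)    ≈⟨ *ₚ-∷ q a p ⟨
      q *ₚ (a ∷ p)               ∎

    *ₚ-cong : ∀ {p p′ q q′} → p ≋ p′ → q ≋ q′ → p *ₚ q ≋ p′ *ₚ q′
    *ₚ-cong {p} {p′} {q} {q′} p≋p′ q≋q′ = begin
      p *ₚ q      ≈⟨ *ₚ-congˡ p q≋q′ ⟩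
      p *ₚ q′     ≈⟨ *ₚ-comm p q′ ⟩
      q′ *ₚ p     ≈⟨ *ₚ-congˡ q′ p≋p′ ⟩
      q′ *ₚ p′    ≈⟨ *ₚ-comm q′ p′ ⟩
      p′ *ₚ q′    ∎

    *ₚ-distribˡ-+ : ∀ p q r → p *ₚ (q +ₚ r) ≋ p *ₚ q +ₚ p *ₚ r
    *ₚ-distribˡ-+ []      q r = ≋-refl
    *ₚ-distribˡ-+ (a ∷ p) q r = begin
      a ·ₚ (q +ₚ r) +ₚ (0# ∷ p *ₚ (q +ₚ r))
        ≈⟨ +ₚ-cong (·-distribˡ-+ a q r) (≋-trans (shift-cong (*ₚ-distribˡ-+ p q r)) (shift-+ (p *ₚ q) (p *ₚ r))) ⟩
      (a ·ₚ q +ₚ a ·ₚ r) +ₚ ((0# ∷ p *ₚ q) +ₚ (0# ∷ p *ₚ r))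
        ≈⟨ +ₚ-interchange (a ·ₚ q) (a ·ₚ r) (0# ∷ p *ₚ q) (0# ∷ p *ₚ r) ⟩
      (a ·ₚ q +ₚ (0# ∷ p *ₚ q)) +ₚ (a ·ₚ r +ₚ (0# ∷ p *ₚ r)) ∎

    *ₚ-distribʳ-+ : ∀ p q r → (q +ₚ r) *ₚ p ≋ q *ₚ p +ₚ r *ₚ p
    *ₚ-distribʳ-+ p q r = begin
      (q +ₚ r) *ₚ p         ≈⟨ *ₚ-comm (q +ₚ r) p ⟩
      p *ₚ (q +ₚ r)         ≈⟨ *ₚ-distribˡ-+ p q r ⟩
      p *ₚ q +ₚ p *ₚ r      ≈⟨ +ₚ-cong (*ₚ-comm p q) (*ₚ-comm p r) ⟩
      q *ₚ p +ₚ r *ₚ p      ∎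

    shift-*ₚ : ∀ p q → (0# ∷ p) *ₚ q ≋ 0# ∷ (p *ₚ q)
    shift-*ₚ p q = +ₚ-cong (·-zeroˡ q) ≋-refl

    ·-*ₚ-assoc : ∀ a p q → (a ·ₚ p) *ₚ q ≋ a ·ₚ (p *ₚ q)
    ·-*ₚ-assoc a []      q = ≋-refl
    ·-*ₚ-assoc a (b ∷ p) q = begin
      (a * b) ·ₚ q +ₚ (0# ∷ (a ·ₚ p) *ₚ q)
        ≈⟨ +ₚ-cong (·-assoc a b q) (≋-trans (shift-cong (·-*ₚ-assoc a p q)) (≋-sym (·-shift a _))) ⟩
      a ·ₚ (b ·ₚ q) +ₚ a ·ₚ (0# ∷ p *ₚ q)    ≈⟨ ·-distribˡ-+ a (b ·ₚ q) _ ⟨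
      a ·ₚ (b ·ₚ q +ₚ (0# ∷ p *ₚ q))         ∎

    *ₚ-assoc : ∀ p q r → (p *ₚ q) *ₚ r ≋ p *ₚ (q *ₚ r)
    *ₚ-assoc []      q r = ≋-refl
    *ₚ-assoc (a ∷ p) q r = begin
      (a ·ₚ q +ₚ (0# ∷ p *ₚ q)) *ₚ r            ≈⟨ *ₚ-distribʳ-+ r (a ·ₚ q) _ ⟩
      (a ·ₚ q) *ₚ r +ₚ (0# ∷ p *ₚ q) *ₚ r       ≈⟨ +ₚ-cong (·-*ₚ-assoc a q r) (shift-*ₚ (p *ₚ q) r) ⟩
      a ·ₚ (q *ₚ r) +ₚ (0# ∷ (p *ₚ q) *ₚ r)     ≈⟨ +ₚ-cong ≋-refl (shift-cong (*ₚ-assoc p q r)) ⟩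
      a ·ₚ (q *ₚ r) +ₚ (0# ∷ p *ₚ (q *ₚ r))     ∎

    *ₚ-identityˡ : ∀ p → (1# ∷ []) *ₚ p ≋ p
    *ₚ-identityˡ p = begin
      1# ·ₚ p +ₚ (0# ∷ [])    ≈⟨ +ₚ-cong (·-identityˡ p) shift-[] ⟩
      p +ₚ []                 ≈⟨ +ₚ-identityʳ p ⟩
      p                       ∎

    const-* : ∀ a p → (a ∷ []) *ₚ p ≋ a ·ₚ p
    const-* a p = begin
      a ·ₚ p +ₚ (0# ∷ [])    ≈⟨ +ₚ-cong ≋-refl shift-[] ⟩
      a ·ₚ p +ₚ []           ≈⟨ +ₚ-identityʳ (a ·ₚ p) ⟩
      a ·ₚ p                 ∎

  polyRing : CommutativeRing c ℓ
  polyRing = record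
    { Carrier = Poly
    ; _≈_ = _≋_
    ; _+_ = _+ₚ_
    ; _*_ = _*ₚ_
    ; -_ = -ₚ_
    ; 0# = []
    ; 1# = 1# ∷ []
    ; isCommutativeRing = record
      { isRing = record
        { +-isAbelianGroup = record
          { isGroup = record
            { isMonoid = record
              { isSemigroup = record
                { isMagma = record { isEquivalence = Setoid.isEquivalence ≋-setoid ; ∙-cong = +ₚ-cong }
                ; assoc = +ₚ-assoc
                }
              ; identity = (λ _ → ≋-refl) , +ₚ-identityʳ
              }
            ; inverse = (λ p → ≋-trans (+ₚ-comm (-ₚ p) p) (+ₚ-inverseʳ p)) , +ₚ-inverseʳ
            ; ⁻¹-cong = -ₚ-cong
            }
          ; comm = +ₚ-comm
          }
        ; *-cong = *ₚ-cong
        ; *-assoc = *ₚ-assoc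
        ; *-identity = *ₚ-identityˡ , λ p → ≋-trans (*ₚ-comm p (1# ∷ [])) (*ₚ-identityˡ p)
        ; distrib = *ₚ-distribˡ-+ , *ₚ-distribʳ-+
        }
      ; *-comm = *ₚ-comm
      }
    }

  -- The Euler derivation x·d/dx: unlike d/dx it preserves degrees, and it multiplies the n-th
  -- coefficient by n.
  θ : Poly → Poly
  θ []      = []
  θ (a ∷ p) = 0# ∷ (p +ₚ θ p)

  coeff-θ : ∀ p n → coeff (θ p) n ≈ n ×ᴷ coeff p n
  coeff-θ []      zero    = refl
  coeff-θ []      (suc n) = trans (coeff-θ [] n) (sym (+-identityˡ _))
  coeff-θ (a ∷ p) zero    = refl
  coeff-θ (a ∷ p) (suc n) = trans (coeff-+ p (θ p) n) (+-congˡ (coeff-θ p n))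

  θ-cong : ∀ {p q} → p ≋ q → θ p ≋ θ q
  θ-cong {p} {q} (coeffs-≈ p≈q) = coeffs-≈ λ n →
    trans (coeff-θ p n) (trans (×-congʳ n (p≈q n)) (sym (coeff-θ q n)))

  θ-+ : ∀ p q → θ (p +ₚ q) ≋ θ p +ₚ θ q
  θ-+ p q = coeffs-≈ λ n → begin
    coeff (θ (p +ₚ q)) n                      ≈⟨ coeff-θ (p +ₚ q) n ⟩
    n ×ᴷ coeff (p +ₚ q) n                     ≈⟨ ×-congʳ n (coeff-+ p q n) ⟩
    n ×ᴷ (coeff p n + coeff q n)              ≈⟨ ×-distrib-+ _ _ n ⟩
    n ×ᴷ coeff p n + n ×ᴷ coeff q n           ≈⟨ +-cong (coeff-θ p n) (coeff-θ q n) ⟨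
    coeff (θ p) n + coeff (θ q) n             ≈⟨ coeff-+ (θ p) (θ q) n ⟨
    coeff (θ p +ₚ θ q) n                      ∎
    where open SetoidReasoning setoid

  θ-· : ∀ a p → θ (a ·ₚ p) ≋ a ·ₚ θ p
  θ-· a p = coeffs-≈ λ n → begin
    coeff (θ (a ·ₚ p)) n       ≈⟨ coeff-θ (a ·ₚ p) n ⟩
    n ×ᴷ coeff (a ·ₚ p) n      ≈⟨ ×-congʳ n (coeff-· a p n) ⟩
    n ×ᴷ (a * coeff p n)       ≈⟨ ×-comm-* n a _ ⟨
    a * n ×ᴷ coeff p n         ≈⟨ *-congˡ (coeff-θ p n) ⟨
    a * coeff (θ p) n          ≈⟨ coeff-· a (θ p) n ⟨
    coeff (a ·ₚ θ p) n         ∎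
    where open SetoidReasoning setoid

  θ-* : ∀ p q → θ (p *ₚ q) ≋ θ p *ₚ q +ₚ p *ₚ θ q
  θ-* []      q = ≋-refl
  θ-* (a ∷ p) q = begin
    θ (a ·ₚ q +ₚ (0# ∷ p *ₚ q))
      ≈⟨ θ-+ (a ·ₚ q) _ ⟩
    θ (a ·ₚ q) +ₚ (0# ∷ (p *ₚ q +ₚ θ (p *ₚ q)))
      ≈⟨ +ₚ-cong (θ-· a q) (shift-cong (+ₚ-cong (≋-refl {p *ₚ q}) (θ-* p q))) ⟩
    a ·ₚ θ q +ₚ (0# ∷ (p *ₚ q +ₚ (θ p *ₚ q +ₚ p *ₚ θ q)))
      ≈⟨ +ₚ-cong ≋-refl (shift-cong (+ₚ-assoc (p *ₚ q) _ _)) ⟨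
    a ·ₚ θ q +ₚ (0# ∷ ((p *ₚ q +ₚ θ p *ₚ q) +ₚ p *ₚ θ q))
      ≈⟨ +ₚ-cong ≋-refl (shift-cong (+ₚ-cong (*ₚ-distribʳ-+ q p (θ p)) ≋-refl)) ⟨
    a ·ₚ θ q +ₚ (0# ∷ ((p +ₚ θ p) *ₚ q +ₚ p *ₚ θ q))
      ≈⟨ +ₚ-cong ≋-refl (shift-+ ((p +ₚ θ p) *ₚ q) _) ⟩
    a ·ₚ θ q +ₚ ((0# ∷ (p +ₚ θ p) *ₚ q) +ₚ (0# ∷ p *ₚ θ q))
      ≈⟨ PolySemigroup.x∙yz≈y∙xz (a ·ₚ θ q) (0# ∷ (p +ₚ θ p) *ₚ q) (0# ∷ p *ₚ θ q) ⟩
    (0# ∷ (p +ₚ θ p) *ₚ q) +ₚ (a ·ₚ θ q +ₚ (0# ∷ p *ₚ θ q))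
      ≈⟨ +ₚ-cong (shift-*ₚ (p +ₚ θ p) q) ≋-refl ⟨
    (0# ∷ (p +ₚ θ p)) *ₚ q +ₚ (a ·ₚ θ q +ₚ (0# ∷ p *ₚ θ q)) ∎
    where
    open SetoidReasoning ≋-setoid
    module PolySemigroup = CommutativeSemigroupProperties (CommutativeRing.+-commutativeSemigroup polyRing)

  -- Degree bounds

  record Deg≤ (d : ℕ) (p : Poly) : Set ℓ where
    constructor deg≤
    field vanishes : ∀ {n} → d < n → coeff p n ≈ 0#

  open Deg≤ public

  deg-resp : ∀ {d p q} → p ≋ q → Deg≤ d p → Deg≤ d q
  deg-resp p≋q d≤ = deg≤ λ d<n → trans (sym (coeff-≈ p≋q _)) (vanishes d≤ d<n)

  deg-mono : ∀ {d e p} → d ≤ e → Deg≤ d p → Deg≤ e p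
  deg-mono d≤e d≤ = deg≤ λ e<n → vanishes d≤ (ℕₚ.≤-<-trans d≤e e<n)

  deg-[] : ∀ {d} → Deg≤ d []
  deg-[] = deg≤ λ _ → refl

  deg-const : ∀ {d} a → Deg≤ d (a ∷ [])
  deg-const a = deg≤ λ { (s≤s _) → refl }

  deg-+ : ∀ {d p q} → Deg≤ d p → Deg≤ d q → Deg≤ d (p +ₚ q)
  deg-+ {p = p} {q} p≤ q≤ = deg≤ λ {n} d<n →
    trans (coeff-+ p q n) (trans (+-cong (vanishes p≤ d<n) (vanishes q≤ d<n)) (+-identityˡ 0#))

  deg-neg : ∀ {d p} → Deg≤ d p → Deg≤ d (-ₚ p)
  deg-neg {p = p} p≤ = deg≤ λ {n} d<n →
    trans (coeff-neg p n) (trans (-‿cong (vanishes p≤ d<n)) -0#≈0#)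

  deg-· : ∀ {d p} a → Deg≤ d p → Deg≤ d (a ·ₚ p)
  deg-· {p = p} a p≤ = deg≤ λ {n} d<n → trans (coeff-· a p n) (trans (*-congˡ (vanishes p≤ d<n)) (zeroʳ a))

  deg-θ : ∀ {d p} → Deg≤ d p → Deg≤ d (θ p)
  deg-θ {p = p} p≤ = deg≤ λ {n} d<n → trans (coeff-θ p n) (trans (×-congʳ n (vanishes p≤ d<n)) (n×0≈0 n))
    where
    n×0≈0 : ∀ n → n ×ᴷ 0# ≈ 0#
    n×0≈0 zero    = refl
    n×0≈0 (suc n) = trans (+-identityˡ _) (n×0≈0 n)

  deg-length : ∀ p → Deg≤ (length p) p
  deg-length []      = deg-[]
  deg-length (a ∷ p) = deg≤ λ { (s≤s l<n) → vanishes (deg-length p) l<n }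

  deg-shift : ∀ {d p} → Deg≤ d p → Deg≤ (suc d) (0# ∷ p)
  deg-shift p≤ = deg≤ λ { (s≤s d<n) → vanishes p≤ d<n }

  deg-tail : ∀ {d a p} → Deg≤ (suc d) (a ∷ p) → Deg≤ d p
  deg-tail ap≤ = deg≤ λ d<n → vanishes ap≤ (s≤s d<n)

  deg-0-tail : ∀ {a p} → Deg≤ 0 (a ∷ p) → p ≋ []
  deg-0-tail ap≤ = coeffs-≈ λ n → vanishes ap≤ (s≤s z≤n)

  deg-0-* : ∀ {a p} → Deg≤ 0 (a ∷ p) → ∀ q → (a ∷ p) *ₚ q ≋ a ·ₚ q
  deg-0-* {a} {p} ap≤ q = ≋-trans (*ₚ-cong (∷-cong refl (deg-0-tail ap≤)) (≋-refl {q})) (const-* a q)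

  deg-* : ∀ {d e p q} → Deg≤ d p → Deg≤ e q → Deg≤ (d ℕ.+ e) (p *ₚ q)
  deg-* {p = []} p≤ q≤ = deg-[]
  deg-* {zero} {p = a ∷ p} {q} p≤ q≤ = deg-resp (≋-sym (deg-0-* p≤ q)) (deg-· a q≤)
  deg-* {suc d} {e} {p = a ∷ p} p≤ q≤ =
    deg-+ (deg-mono (ℕₚ.m≤n+m e (suc d)) (deg-· a q≤)) (deg-shift (deg-* (deg-tail p≤) q≤))

  -- The bounds need not be attained, so this also compares top coefficients of products whose exact
  -- degree is unknown.
  coeff-*-top : ∀ {d e p q} → Deg≤ d p → Deg≤ e q → coeff (p *ₚ q) (d ℕ.+ e) ≈ coeff p d * coeff q e
  coeff-*-top {p = []} p≤ q≤ = sym (zeroˡ _)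
  coeff-*-top {zero} {e} {a ∷ p} {q} p≤ q≤ = trans (coeff-≈ (deg-0-* p≤ q) e) (coeff-· a q e)
  coeff-*-top {suc d} {e} {a ∷ p} {q} p≤ q≤ = begin
    coeff (a ·ₚ q +ₚ (0# ∷ p *ₚ q)) (suc (d ℕ.+ e))          ≈⟨ coeff-+ (a ·ₚ q) _ (suc (d ℕ.+ e)) ⟩
    coeff (a ·ₚ q) (suc (d ℕ.+ e)) + coeff (p *ₚ q) (d ℕ.+ e)
      ≈⟨ +-cong (vanishes (deg-· a q≤) (s≤s (ℕₚ.m≤n+m e d))) (coeff-*-top (deg-tail p≤) q≤) ⟩
    0# + coeff p d * coeff q e                               ≈⟨ +-identityˡ _ ⟩
    coeff p d * coeff q e                                    ∎
    where open SetoidReasoning setoid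

-- Polynomials over a field of characteristic zero

-- Fields in which inverses exist only up to double negation: this is what can be shown about
-- Cauchy reals without choice, and it suffices since the theorem is a negation.
record StableField {c ℓ} (K : CommutativeRing c ℓ) : Set (c ⊔ ℓ) where
  open CommutativeRing K
  field
    stable  : ∀ {x y} → ¬ ¬ (x ≈ y) → x ≈ y
    inverse : ∀ {x} → ¬ (x ≈ 0#) → ¬ ¬ (∃[ y ] x * y ≈ 1#)
    char0   : ∀ n {x} → SemiringMult._×_ semiring (suc n) x ≈ 0# → x ≈ 0#
    1≉0     : ¬ (1# ≈ 0#)

module FieldPolynomial {c ℓ} (K : CommutativeRing c ℓ) (field′ : StableField K) where
  open CommutativeRing K hiding (zero)
  open StableField field′
  open PolynomialRing K public
  open Polynomial rawRing public using (Poly; coeff; _+ₚ_; _·ₚ_; _*ₚ_)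
  open SemiringMult semiring using (×-comm-*; ×-assoc-*) renaming (_×_ to _×ᴷ_)
  open GroupProperties +-group using (∙-cancelˡ)

  cancel : ∀ {x y} → ¬ (x ≈ 0#) → x * y ≈ 0# → y ≈ 0#
  cancel {x} {y} x≉0 xy≈0 = stable (¬¬-map divide (inverse x≉0))
    where
    open SetoidReasoning setoid
    divide : ∃[ z ] x * z ≈ 1# → y ≈ 0#
    divide (z , xz≈1) = begin
      y              ≈⟨ *-identityˡ y ⟨
      1# * y         ≈⟨ *-congʳ (trans (*-comm z x) xz≈1) ⟨
      (z * x) * y    ≈⟨ *-assoc z x y ⟩
      z * (x * y)    ≈⟨ *-congˡ xy≈0 ⟩
      z * 0#         ≈⟨ zeroʳ z ⟩
      0#             ∎

  ×-cancelʳ : ∀ m n {x} → ¬ (x ≈ 0#) → m ×ᴷ x ≈ n ×ᴷ x → m ≡ n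
  ×-cancelʳ zero    zero    x≉0 eq = ≡.refl
  ×-cancelʳ zero    (suc n) x≉0 eq = contradiction (char0 n (sym eq)) x≉0
  ×-cancelʳ (suc m) zero    x≉0 eq = contradiction (char0 m eq) x≉0
  ×-cancelʳ (suc m) (suc n) x≉0 eq = ≡.cong suc (×-cancelʳ m n x≉0 (∙-cancelˡ _ _ _ eq))

  ≋-stable : ∀ {p q} → ¬ ¬ (p ≋ q) → p ≋ q
  ≋-stable ¬¬p≋q = coeffs-≈ λ n → stable (¬¬-map (λ p≋q → coeff-≈ p≋q n) ¬¬p≋q)

  -- Exact degrees

  Exact : ℕ → Poly → Set ℓ
  Exact d p = Deg≤ d p × ¬ (coeff p d ≈ 0#)

  exact-≤ : ∀ {d b p} → Exact d p → Deg≤ b p → d ≤ b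
  exact-≤ (_ , p_d≉0) p≤b = ℕₚ.≮⇒≥ λ b<d → p_d≉0 (vanishes p≤b b<d)

  exact-* : ∀ {d e p q} → Exact d p → Exact e q → Exact (d ℕ.+ e) (p *ₚ q)
  exact-* (p≤ , p_d≉0) (q≤ , q_e≉0) = deg-* p≤ q≤ ,
    λ top≈0 → q_e≉0 (cancel p_d≉0 (trans (sym (coeff-*-top p≤ q≤)) top≈0))

  exact-resp : ∀ {d p q} → p ≋ q → Exact d p → Exact d q
  exact-resp p≋q (p≤ , p_d≉0) = deg-resp p≋q p≤ , λ q_d≈0 → p_d≉0 (trans (coeff-≈ p≋q _) q_d≈0)

  exact-≉0 : ∀ {d p} → Exact d p → ¬ (p ≋ [])
  exact-≉0 (_ , p_d≉0) p≋0 = p_d≉0 (coeff-≈ p≋0 _)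

  deg-drop : ∀ {d p} → Deg≤ (suc d) p → coeff p (suc d) ≈ 0# → Deg≤ d p
  deg-drop {d} {p} p≤ top≈0 = deg≤ below
    where
    below : ∀ {n} → d < n → coeff p n ≈ 0#
    below {n} d<n with n ℕₚ.≟ suc d
    ... | yes ≡.refl = top≈0
    ... | no n≢1+d   = vanishes p≤ (ℕₚ.≤∧≢⇒< d<n (λ eq → n≢1+d (≡.sym eq)))

  -- The bound is lowered as long as the coefficient there vanishes. Each test is made under a
  -- double negation, and a descent past 0 would make `p` zero.
  exact-below : ∀ b {p} → Deg≤ b p → ¬ (p ≋ []) → ¬ ¬ (∃[ d ] (d ≤ b × Exact d p))
  exact-below b {p} p≤b p≉0 = ¬¬-bind ¬¬-excluded-middle (go b p≤b)
    where
    go : ∀ b → Deg≤ b p → Dec (coeff p b ≈ 0#) → ¬ ¬ (∃[ d ] (d ≤ b × Exact d p))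
    go b p≤b (no p_b≉0) = contradiction (b , ℕₚ.≤-refl , p≤b , p_b≉0)
    go zero p≤0 (yes p_0≈0) _ =
      p≉0 (coeffs-≈ λ { zero → p_0≈0 ; (suc n) → vanishes p≤0 (s≤s z≤n) })
    go (suc b) p≤b (yes p_b≈0) =
      ¬¬-map (λ (d , d≤b , exact) → d , ℕₚ.m≤n⇒m≤1+n d≤b , exact)
        (¬¬-bind ¬¬-excluded-middle (go b (deg-drop p≤b p_b≈0)))

  degree : ∀ {p} → ¬ (p ≋ []) → ¬ ¬ (∃[ d ] Exact d p)
  degree {p} p≉0 = ¬¬-map (λ (d , _ , exact) → d , exact) (exact-below (length p) (deg-length p) p≉0)

  *ₚ-cancel : ∀ {p q} → ¬ (p ≋ []) → p *ₚ q ≋ [] → q ≋ []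
  *ₚ-cancel p≉0 pq≋0 = ≋-stable λ q≉0 →
    degree p≉0 λ (_ , p-exact) → degree q≉0 λ (_ , q-exact) → exact-≉0 (exact-* p-exact q-exact) pq≋0

  1ₚ≉0 : ¬ (1# ∷ [] ≋ [])
  1ₚ≉0 1≋0 = 1≉0 (coeff-≈ 1≋0 0)

  polyDomain : StableDomain polyRing
  polyDomain = record { stable = ≋-stable ; cancel = *ₚ-cancel ; 1≉0 = 1ₚ≉0 }

  module Pᵣ = CommutativeRing polyRing
  open Comaximality polyRing public
  open Domain polyRing polyDomain public

  -- Constants and vanishing Wronskians

  θ≋0⇒deg-0 : ∀ {p} → θ p ≋ [] → Deg≤ 0 p
  θ≋0⇒deg-0 {p} θp≋0 = deg≤ λ { {suc n} _ → char0 n (trans (sym (coeff-θ p (suc n))) (coeff-≈ θp≋0 (suc n))) }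

  deg-0⇒θ≋0 : ∀ {p} → Deg≤ 0 p → θ p ≋ []
  deg-0⇒θ≋0 {p} p≤0 = coeffs-≈ λ
    { zero → coeff-θ p 0 ; (suc n) → vanishes (deg-θ p≤0) (s≤s z≤n) }

  -- The hypothesis says that p/q has derivative zero. With `e` the degree of `q`, a multiple of `q`
  -- is subtracted from `p` so that the coefficient at `e` disappears. The difference `h` satisfies
  -- the same equation, which forces the degree of a nonzero `h` to be `e`, contrary to the choice
  -- of the multiple.
  proportional : ∀ {p q} → ¬ (q ≋ []) → q *ₚ θ p ≋ θ q *ₚ p → ¬ ¬ (∃[ a ] (θ a ≋ [] × p ≋ a *ₚ q))
  proportional {p} {q} q≉0 W≋0 = ¬¬-bind (degree q≉0) λ (e , q-exact) →
    ¬¬-map (λ (b , q_e*b≈1) → ratio e b ∷ [] , shift-[] , quotient e b q-exact q_e*b≈1) (inverse (proj₂ q-exact))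
    where
    ratio : ℕ → Carrier → Carrier
    ratio e b = coeff p e * b
    quotient : ∀ e b → Exact e q → coeff q e * b ≈ 1# → p ≋ (ratio e b ∷ []) *ₚ q
    quotient e b (q≤ , q_e≉0) q_e*b≈1 = ≋-stable λ p≉aq → degree (h≉0 p≉aq) degree-clash
      where
      a h : Poly
      a = ratio e b ∷ []
      h = p +ₚ (-ₚ (a *ₚ q))

      module _ where
        open GroupProperties Pᵣ.+-group using (x∙y⁻¹≈ε⇒x≈y)

        h≉0 : ¬ (p ≋ a *ₚ q) → ¬ (h ≋ [])
        h≉0 p≉aq h≋0 = p≉aq (x∙y⁻¹≈ε⇒x≈y p (a *ₚ q) h≋0)

      h+aq≋p : h +ₚ a *ₚ q ≋ p
      h+aq≋p = ≋-trans (Pᵣ.+-assoc p _ _) (≋-trans (Pᵣ.+-congˡ {p} (Pᵣ.-‿inverseˡ (a *ₚ q))) (Pᵣ.+-identityʳ p))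

      -- The equation is linear in `p` and holds for `a *ₚ q` because `a` is constant, so it passes
      -- to `h`.
      W-h≋0 : q *ₚ θ h ≋ θ q *ₚ h
      W-h≋0 = PG.∙-cancelʳ (θ q *ₚ (a *ₚ q)) _ _ (begin
        q *ₚ θ h +ₚ θ q *ₚ (a *ₚ q)        ≈⟨ Pᵣ.+-congˡ {q *ₚ θ h} (begin
          θ q *ₚ (a *ₚ q)                    ≈⟨ Pᵣ.*-congˡ {θ q} (Pᵣ.*-comm a q) ⟩
          θ q *ₚ (q *ₚ a)                    ≈⟨ PS.x∙yz≈y∙xz (θ q) q a ⟩
          q *ₚ (θ q *ₚ a)                    ≈⟨ Pᵣ.*-congˡ {q} (Pᵣ.*-comm (θ q) a) ⟩
          q *ₚ (a *ₚ θ q)                    ≈⟨ Pᵣ.*-congˡ {q} θ[aq]≋aθq ⟨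
          q *ₚ θ (a *ₚ q)                    ∎) ⟩
        q *ₚ θ h +ₚ q *ₚ θ (a *ₚ q)        ≈⟨ Pᵣ.distribˡ q (θ h) _ ⟨
        q *ₚ (θ h +ₚ θ (a *ₚ q))           ≈⟨ Pᵣ.*-congˡ {q} (θ-+ h _) ⟨
        q *ₚ θ (h +ₚ a *ₚ q)               ≈⟨ Pᵣ.*-congˡ {q} (θ-cong h+aq≋p) ⟩
        q *ₚ θ p                           ≈⟨ W≋0 ⟩
        θ q *ₚ p                           ≈⟨ Pᵣ.*-congˡ {θ q} h+aq≋p ⟨
        θ q *ₚ (h +ₚ a *ₚ q)               ≈⟨ Pᵣ.distribˡ (θ q) h _ ⟩
        θ q *ₚ h +ₚ θ q *ₚ (a *ₚ q)        ∎)
        where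
        open SetoidReasoning ≋-setoid
        module PG = GroupProperties Pᵣ.+-group
        module PS = CommutativeSemigroupProperties Pᵣ.*-commutativeSemigroup
        θ[aq]≋aθq : θ (a *ₚ q) ≋ a *ₚ θ q
        θ[aq]≋aθq = ≋-trans (θ-* a q) (+ₚ-cong {q = a *ₚ θ q} (Pᵣ.*-congʳ {q} {θ a} {[]} shift-[]) ≋-refl)

      h_e≈0 : coeff h e ≈ 0#
      h_e≈0 = begin
        coeff (p +ₚ (-ₚ (a *ₚ q))) e             ≈⟨ coeff-+ p _ e ⟩
        coeff p e + coeff (-ₚ (a *ₚ q)) e        ≈⟨ +-congˡ (coeff-neg (a *ₚ q) e) ⟩
        coeff p e + - coeff (a *ₚ q) e           ≈⟨ +-congˡ (-‿cong (begin
          coeff (a *ₚ q) e                         ≈⟨ coeff-≈ (const-* (ratio e b) q) e ⟩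
          coeff (ratio e b ·ₚ q) e                 ≈⟨ coeff-· (ratio e b) q e ⟩
          coeff p e * b * coeff q e                ≈⟨ *-assoc _ _ _ ⟩
          coeff p e * (b * coeff q e)              ≈⟨ *-congˡ (trans (*-comm _ _) q_e*b≈1) ⟩
          coeff p e * 1#                           ≈⟨ *-identityʳ _ ⟩
          coeff p e                                ∎)) ⟩
        coeff p e + - coeff p e                  ≈⟨ -‿inverseʳ _ ⟩
        0#                                       ∎
        where open SetoidReasoning setoid

      -- The top coefficients of q θ h and θ q · h are d · q_e h_d and e · q_e h_d.
      degree-clash : ¬ (∃[ d ] Exact d h)
      degree-clash (d , h≤ , h_d≉0)
        with ×-cancelʳ d e {coeff q e * coeff h d} (λ x≈0 → h_d≉0 (cancel q_e≉0 x≈0)) (begin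
          d ×ᴷ (coeff q e * coeff h d)       ≈⟨ ×-comm-* d _ _ ⟨
          coeff q e * d ×ᴷ coeff h d         ≈⟨ *-congˡ (coeff-θ h d) ⟨
          coeff q e * coeff (θ h) d          ≈⟨ coeff-*-top q≤ (deg-θ h≤) ⟨
          coeff (q *ₚ θ h) (e ℕ.+ d)         ≈⟨ coeff-≈ W-h≋0 (e ℕ.+ d) ⟩
          coeff (θ q *ₚ h) (e ℕ.+ d)         ≈⟨ coeff-*-top (deg-θ q≤) h≤ ⟩
          coeff (θ q) e * coeff h d          ≈⟨ *-congʳ (coeff-θ q e) ⟩
          e ×ᴷ coeff q e * coeff h d         ≈⟨ ×-assoc-* e _ _ ⟩
          e ×ᴷ (coeff q e * coeff h d)       ∎)
        where open SetoidReasoning setoid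
      ... | ≡.refl = h_d≉0 h_e≈0

  open Differential θ θ-cong θ-+ θ-* proportional public
  open SmallKernel Deg≤ deg-mono deg-[] (deg-const 1#) deg-+ deg-neg deg-* public

  -- Euclidean division and common factors

  -- Recursion on the dividend as in Horner's scheme: the division of `p` is multiplied by the
  -- variable, after which the remainder may reach degree `d`, and a scalar multiple `s` of `h`
  -- removes that one coefficient. Here `b` inverts the leading coefficient. Asking that the
  -- remainder vanish from `d` on makes sense also for `d` = 0.
  division : ∀ {h d b} → Deg≤ d h → coeff h d * b ≈ 1# → ∀ p →
    ∃[ a ] ∃[ r ] (p ≋ h *ₚ a +ₚ r × (∀ {n} → d ≤ n → coeff r n ≈ 0#))
  division {h} h≤ h_d*b≈1 [] = [] , [] , ≋-sym (≋-trans (+ₚ-identityʳ (h *ₚ [])) (*ₚ-zeroʳ h)) , λ _ → refl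
  division {h} {d} {b} h≤ h_d*b≈1 (x ∷ p) with division h≤ h_d*b≈1 p
  ... | a , r , p≋ha+r , r<d = s ∷ a , (x ∷ r) +ₚ (-ₚ (s ·ₚ h)) , quotient , remainder
    where
    s : Carrier
    s = coeff (x ∷ r) d * b

    quotient : x ∷ p ≋ h *ₚ (s ∷ a) +ₚ ((x ∷ r) +ₚ (-ₚ (s ·ₚ h)))
    quotient = begin
      x ∷ p
        ≈⟨ ∷-cong (sym (+-identityˡ x)) p≋ha+r ⟩
      (0# ∷ h *ₚ a) +ₚ (x ∷ r)
        ≈⟨ Pᵣ.+-identityˡ _ ⟨
      [] +ₚ ((0# ∷ h *ₚ a) +ₚ (x ∷ r))
        ≈⟨ Pᵣ.+-congʳ (Pᵣ.-‿inverseʳ (s ·ₚ h)) ⟨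
      (s ·ₚ h +ₚ (-ₚ (s ·ₚ h))) +ₚ ((0# ∷ h *ₚ a) +ₚ (x ∷ r))
        ≈⟨ +ₚ-interchange (s ·ₚ h) _ (0# ∷ h *ₚ a) (x ∷ r) ⟩
      (s ·ₚ h +ₚ (0# ∷ h *ₚ a)) +ₚ ((-ₚ (s ·ₚ h)) +ₚ (x ∷ r))
        ≈⟨ +ₚ-cong (≋-sym (*ₚ-∷ h s a)) (+ₚ-comm (-ₚ (s ·ₚ h)) (x ∷ r)) ⟩
      h *ₚ (s ∷ a) +ₚ ((x ∷ r) +ₚ (-ₚ (s ·ₚ h))) ∎
      where open SetoidReasoning ≋-setoid

    coeff-remainder : ∀ n → coeff ((x ∷ r) +ₚ (-ₚ (s ·ₚ h))) n ≈ coeff (x ∷ r) n + - (s * coeff h n)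
    coeff-remainder n = trans (coeff-+ (x ∷ r) (-ₚ (s ·ₚ h)) n)
      (+-congˡ (trans (coeff-neg (s ·ₚ h) n) (-‿cong (coeff-· s h n))))

    remainder : ∀ {n} → d ≤ n → coeff ((x ∷ r) +ₚ (-ₚ (s ·ₚ h))) n ≈ 0#
    remainder {n} d≤n with d ℕₚ.≟ n
    ... | yes ≡.refl = begin
      coeff ((x ∷ r) +ₚ (-ₚ (s ·ₚ h))) d                       ≈⟨ coeff-remainder d ⟩
      coeff (x ∷ r) d + - (coeff (x ∷ r) d * b * coeff h d)    ≈⟨ +-congˡ (-‿cong (*-assoc _ _ _)) ⟩
      coeff (x ∷ r) d + - (coeff (x ∷ r) d * (b * coeff h d))
        ≈⟨ +-congˡ (-‿cong (*-congˡ (trans (*-comm _ _) h_d*b≈1))) ⟩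
      coeff (x ∷ r) d + - (coeff (x ∷ r) d * 1#)               ≈⟨ +-congˡ (-‿cong (*-identityʳ _)) ⟩
      coeff (x ∷ r) d + - coeff (x ∷ r) d                      ≈⟨ -‿inverseʳ _ ⟩
      0#                                                       ∎
      where open SetoidReasoning setoid
    ... | no d≢n with ℕₚ.≤∧≢⇒< d≤n d≢n
    ...   | d<n@(s≤s d≤n′) = begin
      coeff ((x ∷ r) +ₚ (-ₚ (s ·ₚ h))) n      ≈⟨ coeff-remainder n ⟩
      coeff (x ∷ r) n + - (s * coeff h n)     ≈⟨ +-cong (r<d d≤n′) (-‿cong (*-congˡ (vanishes h≤ d<n))) ⟩
      0# + - (s * 0#)                         ≈⟨ +-cong refl (-‿cong (zeroʳ s)) ⟩
      0# + - 0#                               ≈⟨ -‿inverseʳ 0# ⟩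
      0#                                      ∎
      where open SetoidReasoning setoid

  -- An element of the ideal divides all generators unless some remainder is nonzero, and such a
  -- remainder is an element of smaller degree. The number `N` bounds the degree and makes this
  -- descent terminate.
  ideal-generator : ∀ {k} (f : Fin k → Poly) d {h} → Ideal f h → Exact d h →
    ¬ ¬ (∃[ g ] (Ideal f g × ¬ (g ≋ []) × ∀ i → ∃[ a ] f i ≋ g *ₚ a))
  ideal-generator {k} f d = descend d ℕₚ.≤-refl
    where
    Generator : Set _
    Generator = ∃[ g ] (Ideal f g × ¬ (g ≋ []) × ∀ i → ∃[ a ] f i ≋ g *ₚ a)

    descend : ∀ N {d h} → d ≤ N → Ideal f h → Exact d h → ¬ ¬ Generator
    descend N {d} {h} d≤N h∈ h-exact@(h≤ , h_d≉0) = ¬¬-bind (inverse h_d≉0) λ (b , h_d*b≈1) →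
      divide (λ i → division h≤ h_d*b≈1 (f i))
      where
      divide : (∀ i → ∃[ a ] ∃[ r ] (f i ≋ h *ₚ a +ₚ r × (∀ {n} → d ≤ n → coeff r n ≈ 0#))) → ¬ ¬ Generator
      divide division = ¬¬-bind ¬¬-excluded-middle λ
        { (yes r≋0) → contradiction (h , h∈ , exact-≉0 h-exact , λ i → a i ,
            ≋-trans (f≋ i) (≋-trans (Pᵣ.+-congˡ {h *ₚ a i} (r≋0 i)) (+ₚ-identityʳ _)))
        ; (no r≉0) → ¬¬-bind (¬∀⇒¬¬∃¬ ≋-stable r≉0) λ (i , rᵢ≉0) → smaller N d≤N i rᵢ≉0 (r<d i)
        }
        where
        a r : Fin k → Poly
        a i = proj₁ (division i)
        r i = proj₁ (proj₂ (division i))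
        f≋ : ∀ i → f i ≋ h *ₚ a i +ₚ r i
        f≋ i = proj₁ (proj₂ (proj₂ (division i)))
        r<d : ∀ i {n} → d ≤ n → coeff (r i) n ≈ 0#
        r<d i = proj₂ (proj₂ (proj₂ (division i)))

        r∈ : ∀ i → Ideal f (r i)
        r∈ i = resp (begin
          f i +ₚ (-ₚ a i) *ₚ h                     ≈⟨ Pᵣ.+-comm (f i) _ ⟩
          (-ₚ a i) *ₚ h +ₚ f i
            ≈⟨ Pᵣ.+-cong (≋-trans (≋-sym (PR.-‿distribˡ-* (a i) h)) (Pᵣ.-‿cong (Pᵣ.*-comm (a i) h))) (f≋ i) ⟩
          (-ₚ (h *ₚ a i)) +ₚ (h *ₚ a i +ₚ r i)     ≈⟨ Pᵣ.+-assoc (-ₚ (h *ₚ a i)) _ _ ⟨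
          ((-ₚ (h *ₚ a i)) +ₚ h *ₚ a i) +ₚ r i     ≈⟨ Pᵣ.+-congʳ (Pᵣ.-‿inverseˡ (h *ₚ a i)) ⟩
          r i                                      ∎)
          (add (gen i) (mul (-ₚ a i) h∈))
          where
          open SetoidReasoning ≋-setoid
          module PR = RingProperties Pᵣ.ring

        smaller : ∀ N → d ≤ N → ∀ i → ¬ (r i ≋ []) → (∀ {n} → d ≤ n → coeff (r i) n ≈ 0#) → ¬ ¬ Generator
        smaller zero z≤n i rᵢ≉0 rᵢ<d = contradiction (coeffs-≈ λ n → rᵢ<d z≤n) rᵢ≉0
        smaller (suc N) d≤1+N i rᵢ≉0 rᵢ<d =
          ¬¬-bind (exact-below N (deg≤ λ N<n → rᵢ<d (ℕₚ.≤-trans d≤1+N N<n)) rᵢ≉0) λ (e , e≤N , r-exact) →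
            descend N e≤N (r∈ i) r-exact

  -- Since `g` itself lies in the ideal of `f`, dividing its derivation by `g` shows g = g q with q
  -- in the ideal of the quotients; cancelling `g` gives q = 1.
  coprime-quotients : ∀ {k} (f : Fin k → Poly) → ¬ (∀ i → f i ≋ []) →
    ¬ ¬ (∃[ g ] Σ[ a ∈ (Fin k → Poly) ] ((∀ i → f i ≋ g *ₚ a i) × ¬ (g ≋ []) × Ideal a (1# ∷ [])))
  coprime-quotients {k} f f≉0 = ¬¬-bind (¬∀⇒¬¬∃¬ ≋-stable f≉0) λ (i , fᵢ≉0) →
    ¬¬-bind (degree fᵢ≉0) λ (d , exact) → ¬¬-map quotients (ideal-generator f d (gen i) exact)
    where
    quotients : ∃[ g ] (Ideal f g × ¬ (g ≋ []) × ∀ i → ∃[ a ] f i ≋ g *ₚ a) → _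
    quotients (g , g∈ , g≉0 , divides) = g , a , f≋ga , g≉0 , unit (quotient g∈)
      where
      a : Fin k → Poly
      a i = proj₁ (divides i)
      f≋ga : ∀ i → f i ≋ g *ₚ a i
      f≋ga i = proj₂ (divides i)
      quotient : ∀ {p} → Ideal f p → ∃[ q ] (p ≋ g *ₚ q × Ideal a q)
      quotient (gen i) = a i , f≋ga i , gen i
      quotient (add p∈ p′∈) with quotient p∈ | quotient p′∈
      ... | q , p≋gq , q∈ | q′ , p′≋gq′ , q′∈ =
        q +ₚ q′ , ≋-trans (+ₚ-cong p≋gq p′≋gq′) (≋-sym (Pᵣ.distribˡ g q q′)) , add q∈ q′∈
      quotient (mul r p∈) with quotient p∈
      ... | q , p≋gq , q∈ = r *ₚ q ,
        ≋-trans (Pᵣ.*-congˡ {r} p≋gq)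
          (CommutativeSemigroupProperties.x∙yz≈y∙xz Pᵣ.*-commutativeSemigroup r g q) ,
        mul r q∈
      quotient (resp p≋p′ p∈) with quotient p∈
      ... | q , p≋gq , q∈ = q , ≋-trans (≋-sym p≋p′) p≋gq , q∈
      unit : ∃[ q ] (g ≋ g *ₚ q × Ideal a q) → Ideal a (1# ∷ [])
      unit (q , g≋gq , q∈) = resp (*-cancelˡ g≉0 (≋-trans (≋-sym g≋gq) (≋-sym (Pᵣ.*-identityʳ g)))) q∈

-- Power sums of polynomials

module PowerSums {c ℓ} (K : CommutativeRing c ℓ) (field′ : StableField K) where
  open CommutativeRing K using (0#; 1#; rawRing)
  open StableField field′
  open FieldPolynomial K field′
  open CommutativeRing polyRing using (_+_; _*_; -_; +-cong; +-congʳ; *-congˡ; *-congʳ;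
    *-assoc; *-comm; *-identityˡ; *-identityʳ; +-identityˡ; +-identityʳ; zeroˡ; zeroʳ;
    semiring; commutativeSemiring; *-commutativeSemigroup)
  open SemiringExp semiring using (^-congˡ)
  open SemiringSum semiring using (sum-remove)
  open CommutativeSemiringExp commutativeSemiring using (^-distrib-*)
  open CommutativeSemigroupProperties *-commutativeSemigroup using (x∙yz≈y∙xz; xy∙z≈y∙xz; interchange)
  open SetoidReasoning ≋-setoid

  0ₚ : Poly
  0ₚ = []

  exact-^ : ∀ {d p} n → Exact d p → Exact (n ℕ.* d) (p ^ n)
  exact-^ zero    exact = deg-const 1# , 1≉0
  exact-^ (suc n) exact = exact-* exact (exact-^ n exact)

  commonDegree : ∀ {k} (f : Fin k → Poly) → ∃[ N ] (∀ i → Deg≤ N (f i))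
  commonDegree {zero}  f = 0 , λ ()
  commonDegree {suc k} f with commonDegree (λ i → f (suc i))
  ... | N , f₊≤N = length (f zero) ℕ.⊔ N , λ
    { zero → deg-mono (ℕₚ.m≤m⊔n (length (f zero)) N) (deg-length (f zero))
    ; (suc i) → deg-mono (ℕₚ.m≤n⊔m (length (f zero)) N) (f₊≤N i) }

  -- The attained maximum is written `suc D` because the final estimate cancels this factor, which
  -- therefore has to be positive.
  constant-or-maxDegree : ∀ {k} (f : Fin k → Poly) →
    ¬ ¬ ((∀ i → Deg≤ 0 (f i)) ⊎ ∃[ D ] ((∀ i → Deg≤ (suc D) (f i)) × ∃[ l ] Exact (suc D) (f l)))
  constant-or-maxDegree {k} f with commonDegree f
  ... | N , f≤N = descend N f≤N
    where
    descend : ∀ N → (∀ i → Deg≤ N (f i)) →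
      ¬ ¬ ((∀ i → Deg≤ 0 (f i)) ⊎ ∃[ D ] ((∀ i → Deg≤ (suc D) (f i)) × ∃[ l ] Exact (suc D) (f l)))
    descend zero    f≤0 = contradiction (inj₁ f≤0)
    descend (suc N) f≤  = ¬¬-bind ¬¬-excluded-middle λ
      { (yes top≈0) → descend N (λ i → deg-drop (f≤ i) (top≈0 i))
      ; (no top≉0)  → ¬¬-map (λ (l , top≉0) → inj₂ (N , f≤ , l , f≤ l , top≉0)) (¬∀⇒¬¬∃¬ stable top≉0)
      }

  -- Homogeneity in the entry degree: the bound on the kernel vector scales with the maximal degree
  -- of the polynomials, which then drops out of the inequality for the exponent.
  kernelBound-* : ∀ k B d → kernelBound k (B ℕ.* d) ≡ kernelBound k B ℕ.* d
  kernelBound-* zero    B d = ≡.refl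
  kernelBound-* (suc k) B d = ≡.trans
    (≡.cong (B ℕ.* d ℕ.+_)
      (≡.trans (≡.cong (kernelBound k) (≡.sym (ℕₚ.*-distribʳ-+ d B B))) (kernelBound-* k (B ℕ.+ B) d)))
    (≡.sym (ℕₚ.*-distribʳ-+ d B (kernelBound k (B ℕ.+ B))))

  -- Powers of a polynomial that divide derivatives

  module Multiples {D f} (f≤ : Deg≤ D f) where

    -- Divisibility by `f ^ e` with a cofactor of degree at most `B`. One derivative costs one
    -- factor `f` and adds `D` to the bound on the cofactor.
    _·f^_ : ℕ → ℕ → Poly → Set (c ⊔ ℓ)
    (B ·f^ e) y = ∃[ A ] (y ≋ f ^ e * A × Deg≤ B A)

    θ-^ : ∀ e → (D ·f^ e) (θ (f ^ suc e))
    θ-^ zero = θ f , (begin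
      θ (f * (1# ∷ []))    ≈⟨ θ-cong (*-identityʳ f) ⟩
      θ f                  ≈⟨ *-identityˡ (θ f) ⟨
      (1# ∷ []) * θ f      ∎) , deg-θ f≤
    θ-^ (suc e) with θ-^ e
    ... | Q , θf^≋ , Q≤ = θ f + Q , θ-^-suc e θf^≋ , deg-+ (deg-θ f≤) Q≤

    θ-multiple : ∀ {e B y} → (B ·f^ suc e) y → ((D ℕ.+ B) ·f^ e) (θ y)
    θ-multiple {e} {B} {y} (A , y≋ , A≤) with θ-^ e
    ... | Q , θf^≋ , Q≤ = Q * A + f * θ A , ≋-trans (θ-cong y≋) (θ-^-* e A θf^≋) ,
      deg-+ (deg-* Q≤ A≤) (deg-* f≤ (deg-θ A≤))

    lower-multiple : ∀ {e B y} → (B ·f^ suc e) y → ((D ℕ.+ B) ·f^ e) y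
    lower-multiple {e} {B} {y} (A , y≋ , A≤) = f * A ,
      ≋-trans y≋ (xy∙z≈y∙xz f (f ^ e) A) , deg-* f≤ A≤

    θ^-multiple : ∀ j {e B y} → (B ·f^ (j ℕ.+ e)) y → ((j ℕ.* D ℕ.+ B) ·f^ e) (θ^ j y)
    θ^-multiple zero y-mult = y-mult
    θ^-multiple (suc j) {e} {B} {y} y-mult = ≡.subst (λ n → (n ·f^ e) (θ (θ^ j y)))
      (≡.sym (ℕₚ.+-assoc D (j ℕ.* D) B))
      (θ-multiple {e} {j ℕ.* D ℕ.+ B}
        (θ^-multiple j {suc e} (≡.subst (λ n → (B ·f^ n) y) (≡.sym (ℕₚ.+-suc j e)) y-mult)))

    lower^-multiple : ∀ j {e B y} → (B ·f^ (j ℕ.+ e)) y → ((j ℕ.* D ℕ.+ B) ·f^ e) y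
    lower^-multiple zero y-mult = y-mult
    lower^-multiple (suc j) {e} {B} {y} y-mult = ≡.subst (λ n → (n ·f^ e) y)
      (≡.sym (ℕₚ.+-assoc D (j ℕ.* D) B))
      (lower-multiple {e} {j ℕ.* D ℕ.+ B}
        (lower^-multiple j {suc e} (≡.subst (λ n → (B ·f^ n) y) (≡.sym (ℕₚ.+-suc j e)) y-mult)))

    -- After `j` derivatives, a further J - j factors `f` are moved into the cofactor. All rows then
    -- share the exponent `n` and the degree bound, whatever `j` is.
    derivatives : ∀ {J j n m a} → J ℕ.+ n ≡ m → j ≤ J → Deg≤ 0 a → ((J ℕ.* D) ·f^ n) (θ^ j (a * f ^ m))
    derivatives {J} {j} {n} {m} {a} J+n≡m j≤J a≤0 = ≡.subst (λ B → (B ·f^ n) (θ^ j y)) degrees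
      (lower^-multiple (J ℕ.∸ j) {n} (θ^-multiple j {J ℕ.∸ j ℕ.+ n} {0} {y} (a , y≋ , a≤0)))
      where
      y : Poly
      y = a * f ^ m
      exponents : j ℕ.+ (J ℕ.∸ j ℕ.+ n) ≡ m
      exponents = ≡.trans (≡.sym (ℕₚ.+-assoc j (J ℕ.∸ j) n)) (≡.trans (≡.cong (ℕ._+ n) (ℕₚ.m+[n∸m]≡n j≤J)) J+n≡m)
      y≋ : y ≋ f ^ (j ℕ.+ (J ℕ.∸ j ℕ.+ n)) * a
      y≋ = ≡.subst (λ e → y ≋ f ^ e * a) (≡.sym exponents) (*-comm a _)
      degrees : (J ℕ.∸ j) ℕ.* D ℕ.+ (j ℕ.* D ℕ.+ 0) ≡ J ℕ.* D
      degrees = ≡.trans (≡.cong ((J ℕ.∸ j) ℕ.* D ℕ.+_) (ℕₚ.+-identityʳ (j ℕ.* D)))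
        (≡.trans (≡.sym (ℕₚ.*-distribʳ-+ D (J ℕ.∸ j) j)) (≡.cong (ℕ._* D) (ℕₚ.m∸n+n≡m j≤J)))

  -- Independence of powers over the constants

  -- Scalars appear as polynomials killed by `θ`, to match `ConstantRelation`. Nonvanishing is a
  -- clause of its own because for a single polynomial the other clause is vacuous.
  Nonproportional : ∀ {k} → (Fin k → Poly) → Set (c ⊔ ℓ)
  Nonproportional f = (∀ i → ¬ (f i ≋ 0ₚ)) × (∀ i j → i ≢ j → ∀ a → θ a ≋ 0ₚ → ¬ (f i ≋ a * f j))

  -- The form of the theorem that supports induction on `k`; the theorem is the case where all
  -- coefficients are 1.
  IndependentPowers : ℕ → ℕ → Set (c ⊔ ℓ)
  IndependentPowers k m = ∀ (f : Fin k → Poly) → Nonproportional f →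
    ∀ (a : Fin k → Poly) → (∀ i → θ (a i) ≋ 0ₚ) → sum (λ i → a i * f i ^ m) ≋ 0ₚ → ∀ i → a i ≋ 0ₚ

  nonproportional-∘ : ∀ {k l} {f : Fin k → Poly} (σ : Fin l → Fin k) → (∀ {i j} → σ i ≡ σ j → i ≡ j) →
    Nonproportional f → Nonproportional (λ i → f (σ i))
  nonproportional-∘ σ σ-injective (f≉0 , f≁) =
    (λ i → f≉0 (σ i)) , λ i j i≢j → f≁ (σ i) (σ j) (λ eq → i≢j (σ-injective eq))

  -- Without the term `l` this is a relation between one polynomial fewer, to which independence
  -- applies.
  remove-zero : ∀ {k m} → IndependentPowers k m → (f : Fin (suc k) → Poly) → Nonproportional f →
    ∀ (a : Fin (suc k) → Poly) → (∀ i → θ (a i) ≋ 0ₚ) → sum (λ i → a i * f i ^ m) ≋ 0ₚ →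
    ∀ l → a l ≋ 0ₚ → ∀ i → a i ≋ 0ₚ
  remove-zero {k} {m} independent f f≁ a θa≋0 relation l a_l≋0 i with l Finₚ.≟ i
  ... | yes ≡.refl = a_l≋0
  ... | no l≢i = ≡.subst (λ j → a j ≋ 0ₚ) (Finₚ.punchIn-punchOut l≢i) (others (punchOut l≢i))
    where
    t : Fin (suc k) → Poly
    t i = a i * f i ^ m
    others : ∀ j → a (punchIn l j) ≋ 0ₚ
    others = independent (λ j → f (punchIn l j))
      (nonproportional-∘ {f = f} (punchIn l) (Finₚ.punchIn-injective l _ _) f≁)
      (λ j → a (punchIn l j)) (λ j → θa≋0 (punchIn l j)) (begin
        sum (λ j → t (punchIn l j))              ≈⟨ +-identityˡ _ ⟨
        0ₚ + sum (λ j → t (punchIn l j))         ≈⟨ +-congʳ (≋-trans (*-congʳ {f l ^ m} a_l≋0) (zeroˡ (f l ^ m))) ⟨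
        t l + sum (λ j → t (punchIn l j))        ≈⟨ sum-remove {i = l} t ⟨
        sum t                                    ≈⟨ relation ⟩
        0ₚ                                       ∎)

  constants-proportional : ∀ {p q} → ¬ (q ≋ 0ₚ) → Deg≤ 0 p → Deg≤ 0 q → ¬ ¬ (∃[ a ] (θ a ≋ 0ₚ × p ≋ a * q))
  constants-proportional {p} {q} q≉0 p≤0 q≤0 = proportional q≉0
    (≋-trans (*-congˡ {q} (deg-0⇒θ≋0 p≤0)) (≋-trans (zeroʳ q) (≋-sym (*-congʳ {p} (deg-0⇒θ≋0 q≤0)))))

  -- A relation without vanishing coefficients

  module MinimalRelation {J m} n (J+n≡m : J ℕ.+ n ≡ m) (bound<n : kernelBound J J < n)
    (f : Fin J → Poly) (f≉0 : ∀ i → ¬ (f i ≋ 0ₚ)) (f-coprime : Ideal f (1# ∷ []))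
    (a : Fin J → Poly) (θa≋0 : ∀ i → θ (a i) ≋ 0ₚ) (a≉0 : ∀ i → ¬ (a i ≋ 0ₚ))
    (relation : sum (λ i → a i * f i ^ m) ≋ 0ₚ)
    (independent : ∀ (b : Fin J → Poly) → (∀ i → θ (b i) ≋ 0ₚ) → sum (λ i → b i * f i ^ m) ≋ 0ₚ →
      ∀ l → b l ≋ 0ₚ → ∀ i → b i ≋ 0ₚ)
    where

    y u : Fin J → Poly
    y i = a i * f i ^ m
    u i = f i ^ n

    u≉0 : ∀ i → ¬ (u i ≋ 0ₚ)
    u≉0 i = ^-≉0 n (f≉0 i)

    derivative-entry : ∀ {D} → (∀ i → Deg≤ D (f i)) → ∀ (j i : Fin J) →
      ∃[ A ] (θ^ (toℕ j) (y i) ≋ u i * A × Deg≤ (J ℕ.* D) A)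
    derivative-entry f≤ j i = Multiples.derivatives (f≤ i) J+n≡m (ℕₚ.<⇒≤ (Finₚ.toℕ<n j)) (θ≋0⇒deg-0 (θa≋0 i))

    module _ {D l} (f-exact : Exact (suc D) (f l)) (A : Fin J → Fin J → Poly)
      (θ^y≋uA : ∀ j i → θ^ (toℕ j) (y i) ≋ u i * A j i)
      (A≤ : ∀ j i → Deg≤ (J ℕ.* suc D) (A j i))
      where

      A-kernel-u : KernelVector A u
      A-kernel-u = (λ j → begin
        sum (λ i → A j i * u i)
          ≈⟨ sum-cong-≋ (λ i → ≋-trans (*-comm (A j i) (u i)) (≋-sym (θ^y≋uA j i))) ⟩
        sum (λ i → θ^ (toℕ j) (y i))          ≈⟨ θ^-sum (toℕ j) y ⟨
        θ^ (toℕ j) (sum y)                    ≈⟨ θ^-≈0 (toℕ j) relation ⟩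
        0ₚ                                    ∎) , λ u≋0 → u≉0 l (u≋0 l)

      -- Passing from `A j i` to the derivatives means dividing coordinate `i` by `u i`; the factors
      -- `E i` do this up to the common multiple `U`.
      scaled-relations : ∀ {U} {E v : Fin J → Poly} → (∀ i → E i * u i ≋ U) → (∀ j → sum (λ i → v i * A j i) ≋ 0ₚ) →
                         ∀ j → sum (λ i → (v i * E i) * θ^ (toℕ j) (y i)) ≋ 0ₚ
      scaled-relations {U} {E} {v} Eu≋U Av≋0 j = begin
        sum (λ i → (v i * E i) * θ^ (toℕ j) (y i))    ≈⟨ sum-cong-≋ term ⟩
        sum (λ i → U * (v i * A j i))                 ≈⟨ *-distribˡ-sum U (λ i → v i * A j i) ⟨
        U * sum (λ i → v i * A j i)                   ≈⟨ *-congˡ {U} (Av≋0 j) ⟩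
        U * 0ₚ                                        ≈⟨ zeroʳ U ⟩
        0ₚ                                            ∎
        where
        term : ∀ i → (v i * E i) * θ^ (toℕ j) (y i) ≋ U * (v i * A j i)
        term i = begin
          (v i * E i) * θ^ (toℕ j) (y i)    ≈⟨ *-congˡ {v i * E i} (θ^y≋uA j i) ⟩
          (v i * E i) * (u i * A j i)       ≈⟨ *-congʳ {u i * A j i} (*-comm (v i) (E i)) ⟩
          (E i * v i) * (u i * A j i)       ≈⟨ interchange (E i) (v i) (u i) (A j i) ⟩
          (E i * u i) * (v i * A j i)       ≈⟨ *-congʳ {v i * A j i} (Eu≋U i) ⟩
          U * (v i * A j i)                 ∎

      -- A constant relation between the `y i` is one between the powers with coefficients
      -- `e i * a i`. Its coefficient at `l` vanishes with `v l`, so all of them vanish, and the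
      -- `a i` can be cancelled.
      no-constantRelation : ∀ {v : Fin J → Poly} {l} → v l ≋ 0ₚ → ¬ ConstantRelation y v
      no-constantRelation {l = l} v_l≋0 (e , θe≋0 , support , e≉0 , ey≋0) = e≉0 λ i →
        *ₚ-cancel (a≉0 i) (≋-trans (*-comm (a i) (e i)) (ea≋0 i))
        where
        ea≋0 : ∀ i → e i * a i ≋ 0ₚ
        ea≋0 = independent (λ i → e i * a i)
          (λ i → ≋-trans (θ-* (e i) (a i)) (+-cong {θ (e i) * a i} {0ₚ} {e i * θ (a i)} {0ₚ}
            (≋-trans (*-congʳ {a i} (θe≋0 i)) (zeroˡ (a i))) (≋-trans (*-congˡ {e i} (θa≋0 i)) (zeroʳ (e i)))))
          (≋-trans (sum-cong-≋ (λ i → *-assoc (e i) (a i) (f i ^ m))) ey≋0)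
          l (≋-trans (*-congʳ {a l} (support l v_l≋0)) (zeroˡ (a l)))

      relations-vanish : ∀ {v : Fin J → Poly} → (∀ (j : Fin J) → sum (λ i → v i * θ^ (toℕ j) (y i)) ≋ 0ₚ) →
                         ∀ {l} → v l ≋ 0ₚ → ∀ i → v i ≋ 0ₚ
      relations-vanish {v} relations v_l≋0 i = ≋-stable λ vᵢ≉0 → constantRelation J y v
        (λ j j<J → ≡.subst (λ j → sum (λ i → v i * θ^ j (y i)) ≋ 0ₚ) (Finₚ.toℕ-fromℕ< j<J) (relations (fromℕ< j<J)))
        (λ v≋0 → vᵢ≉0 (v≋0 i)) (no-constantRelation {v} v_l≋0)

      -- This is the sense in which the kernel is one-dimensional. The factor `E i` is nonzero and
      -- can be cancelled at the end.
      kernel-vanishes : ∀ (v : Fin J → Poly) → (∀ j → sum (λ i → v i * A j i) ≋ 0ₚ) →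
                        ∀ l → v l ≋ 0ₚ → ∀ i → v i ≋ 0ₚ
      kernel-vanishes v Av≋0 l v_l≋0 i = cancel-complement (complements u u≉0)
        where
        cancel-complement : ∃[ U ] Σ[ E ∈ (Fin J → Poly) ] (∀ i → E i * u i ≋ U) × ¬ (U ≋ 0ₚ) → v i ≋ 0ₚ
        cancel-complement (U , E , Eu≋U , U≉0) = *ₚ-cancel E≉0 (≋-trans (*-comm (E i) (v i))
          (relations-vanish {λ i → v i * E i} (scaled-relations {U} {E} {v} Eu≋U Av≋0) {l}
            (≋-trans (*-congʳ {E l} v_l≋0) (zeroˡ (E l))) i))
          where
          E≉0 : ¬ (E i ≋ 0ₚ)
          E≉0 E≋0 = U≉0 (≋-trans (≋-sym (Eu≋U i)) (≋-trans (*-congʳ {u i} E≋0) (zeroˡ (u i))))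

      -- The combination of `u` and `C` with coefficients `C l` and `- u l` lies in the kernel and
      -- is zero at `l`.
      kernel-proportional : ∀ {C} → KernelVector A C → ∀ l i → C l * u i ≋ u l * C i
      kernel-proportional {C} (AC≋0 , _) l i = x-yz≈0⇒x≈yz {C l * u i} {u l} {C i}
        (kernel-vanishes w Aw≋0 l (x≈yz⇒x-yz≈0 {C l * u l} {u l} {C l} (*-comm (C l) (u l))) i)
        where
        w : Fin J → Poly
        w i = C l * u i + (- u l) * C i
        Aw≋0 : ∀ j → sum (λ i → w i * A j i) ≋ 0ₚ
        Aw≋0 j = begin
          sum (λ i → w i * A j i)
            ≈⟨ sum-linear (C l) (- u l) u C (A j) ⟩
          C l * sum (λ i → u i * A j i) + (- u l) * sum (λ i → C i * A j i)
            ≈⟨ +-cong (*-congˡ {C l} (≋-trans (sum-cong-≋ (λ i → *-comm (u i) (A j i))) (proj₁ A-kernel-u j)))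
                      (*-congˡ { - u l} (≋-trans (sum-cong-≋ (λ i → *-comm (C i) (A j i))) (AC≋0 j))) ⟩
          C l * 0ₚ + (- u l) * 0ₚ
            ≈⟨ +-cong (zeroʳ (C l)) (zeroʳ (- u l)) ⟩
          0ₚ ∎

      -- By proportionality each generator `u i` times `C l` is a multiple of `u l`; this extends to
      -- the ideal of the `u i`, which contains 1.
      u-divides-kernel : ∀ {C} → KernelVector A C → ∀ l → ∃[ q ] C l ≋ u l * q
      u-divides-kernel {C} C-kernel l with quotient (comaximal-^ n f-coprime)
        where
        quotient : ∀ {x} → Ideal u x → ∃[ q ] x * C l ≋ u l * q
        quotient (gen i) = C i , ≋-trans (*-comm (u i) (C l)) (kernel-proportional C-kernel l i)
        quotient (add {x} {y} x∈ y∈) with quotient x∈ | quotient y∈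
        ... | q , xC≋ | q′ , yC≋ = q + q′ ,
          ≋-trans (Pᵣ.distribʳ (C l) x y) (≋-trans (+-cong xC≋ yC≋) (≋-sym (Pᵣ.distribˡ (u l) q q′)))
        quotient (mul r {x} x∈) with quotient x∈
        ... | q , xC≋ = r * q , ≋-trans (*-assoc r x (C l)) (≋-trans (*-congˡ {r} xC≋)
          (x∙yz≈y∙xz r (u l) q))
        quotient (resp x≋y x∈) with quotient x∈
        ... | q , xC≋ = q , ≋-trans (*-congʳ {C l} (≋-sym x≋y)) xC≋
      ... | q , C≋ = q , ≋-trans (≋-sym (*-identityˡ (C l))) C≋

      -- At an index `l` of maximal degree `suc D`, the nonzero multiple `C l` of `u l` has degree
      -- at least n (D + 1), but at most `kernelBound J J` times D + 1; the common factor cancels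
      -- against `bound<n`.
      degree-contradiction : ⊥
      degree-contradiction = smallKernelVector A A-kernel-u A≤ too-small
        where
        too-small : ¬ (Σ[ C ∈ (Fin J → Poly) ] KernelVector A C × (∀ i → Deg≤ (kernelBound J (J ℕ.* suc D)) (C i)))
        too-small (C , C-kernel , C≤) with u-divides-kernel C-kernel l
        ... | q , C≋uq = degree q≉0 λ (d , q-exact) → ℕₚ.<⇒≱ bound<n (ℕₚ.*-cancelʳ-≤ n _ (suc D)
            (ℕₚ.≤-trans (ℕₚ.m≤m+n (n ℕ.* suc D) d)
              (≡.subst (n ℕ.* suc D ℕ.+ d ≤_) (kernelBound-* J J (suc D))
                (exact-≤ (exact-resp (≋-sym C≋uq) (exact-* (exact-^ n f-exact) q-exact)) (C≤ l)))))
          where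
          C_l≉0 : ¬ (C l ≋ 0ₚ)
          C_l≉0 C_l≋0 = proj₂ C-kernel λ i → *ₚ-cancel (u≉0 l)
            (≋-trans (≋-sym (kernel-proportional C-kernel l i)) (≋-trans (*-congʳ {u i} C_l≋0) (zeroˡ (u i))))
          q≉0 : ¬ (q ≋ 0ₚ)
          q≉0 q≋0 = C_l≉0 (≋-trans C≋uq (≋-trans (*-congˡ {u l} q≋0) (zeroʳ (u l))))

  -- Induction on the number of polynomials

  coprime-impossible : ∀ {k m} n → suc (suc k) ℕ.+ n ≡ m → IndependentPowers (suc k) m →
    kernelBound (suc (suc k)) (suc (suc k)) < n → ∀ f → Nonproportional f → Ideal f (1# ∷ []) →
    ∀ a → (∀ i → θ (a i) ≋ 0ₚ) → sum (λ i → a i * f i ^ m) ≋ 0ₚ → ¬ (∀ i → a i ≋ 0ₚ) → ⊥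
  coprime-impossible {m = m} n J+n≡m independent bound<n f f≁ f-coprime a θa≋0 relation a≉0 =
    constant-or-maxDegree f λ
      { (inj₁ f≤0) → constants-proportional (proj₁ f≁ (suc zero)) (f≤0 zero) (f≤0 (suc zero))
          λ (b , θb≋0 , f₀≋bf₁) → proj₂ f≁ zero (suc zero) (λ ()) b θb≋0 f₀≋bf₁
      ; (inj₂ (D , f≤ , l , exact)) →
          let
            open MinimalRelation n J+n≡m bound<n f (proj₁ f≁) f-coprime a θa≋0
              -- One vanishing coefficient would make all of them vanish, so every coefficient is
              -- nonzero.
              (λ l a_l≋0 → a≉0 (remove-zero {m = m} independent f f≁ a θa≋0 relation l a_l≋0))
              relation (remove-zero {m = m} independent f f≁)
            entry = derivative-entry f≤
          in degree-contradiction exact (λ j i → proj₁ (entry j i))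
               (λ j i → proj₁ (proj₂ (entry j i))) (λ j i → proj₂ (proj₂ (entry j i)))
      }

  -- By homogeneity the quotients satisfy the relation with the same coefficients `a`: the common
  -- factor `g` enters only as the factor `g ^ m`.
  independentPowers-suc : ∀ {k m} n → suc (suc k) ℕ.+ n ≡ m → IndependentPowers (suc k) m →
    kernelBound (suc (suc k)) (suc (suc k)) < n → IndependentPowers (suc (suc k)) m
  independentPowers-suc {k} {m} n J+n≡m independent bound<n f f≁ a θa≋0 relation i = ≋-stable λ aᵢ≉0 →
    coprime-quotients f (λ f≋0 → proj₁ f≁ zero (f≋0 zero)) λ (g , b , f≋gb , g≉0 , b-coprime) →
      coprime-impossible {m = m} n J+n≡m independent bound<n b
        (quotients-nonproportional {g} {b} f≋gb) b-coprime a θa≋0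
        (quotients-relation g b f≋gb g≉0) (λ a≋0 → aᵢ≉0 (a≋0 i))
    where
    quotients-nonproportional : ∀ {g b} → (∀ i → f i ≋ g * b i) → Nonproportional b
    quotients-nonproportional {g} {b} f≋gb =
      (λ i b≋0 → proj₁ f≁ i (≋-trans (f≋gb i) (≋-trans (*-congˡ {g} b≋0) (zeroʳ g)))) ,
      λ i j i≢j e θe≋0 bᵢ≋ebⱼ → proj₂ f≁ i j i≢j e θe≋0 (begin
        f i               ≈⟨ f≋gb i ⟩
        g * b i           ≈⟨ *-congˡ {g} bᵢ≋ebⱼ ⟩
        g * (e * b j)     ≈⟨ x∙yz≈y∙xz g e (b j) ⟩
        e * (g * b j)     ≈⟨ *-congˡ {e} (f≋gb j) ⟨
        e * f j           ∎)

    quotients-relation : ∀ g b → (∀ i → f i ≋ g * b i) → ¬ (g ≋ 0ₚ) → sum (λ i → a i * b i ^ m) ≋ 0ₚ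
    quotients-relation g b f≋gb g≉0 = *ₚ-cancel (^-≉0 m g≉0) (begin
      g ^ m * sum (λ i → a i * b i ^ m)         ≈⟨ *-distribˡ-sum (g ^ m) (λ i → a i * b i ^ m) ⟩
      sum (λ i → g ^ m * (a i * b i ^ m))       ≈⟨ sum-cong-≋ term ⟩
      sum (λ i → a i * f i ^ m)                 ≈⟨ relation ⟩
      0ₚ                                        ∎)
      where
      term : ∀ i → g ^ m * (a i * b i ^ m) ≋ a i * f i ^ m
      term i = begin
        g ^ m * (a i * b i ^ m)    ≈⟨ x∙yz≈y∙xz (g ^ m) (a i) (b i ^ m) ⟩
        a i * (g ^ m * b i ^ m)    ≈⟨ *-congˡ {a i} (^-distrib-* g (b i) m) ⟨
        a i * (g * b i) ^ m        ≈⟨ *-congˡ {a i} (^-congˡ m (f≋gb i)) ⟨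
        a i * f i ^ m              ∎

  independentPowers-1 : ∀ m → IndependentPowers 1 m
  independentPowers-1 m f (f≉0 , _) a _ relation zero = *ₚ-cancel (^-≉0 m (f≉0 zero)) (begin
    f zero ^ m * a zero            ≈⟨ *-comm (f zero ^ m) (a zero) ⟩
    a zero * f zero ^ m            ≈⟨ +-identityʳ _ ⟨
    a zero * f zero ^ m + 0ₚ       ≈⟨ relation ⟩
    0ₚ                             ∎)

  independentPowers : ∀ k → ∃[ M ] (∀ m → M ≤ m → IndependentPowers (suc k) m)
  independentPowers zero = 0 , λ m _ → independentPowers-1 m
  independentPowers (suc k) with independentPowers k
  -- The exponent left after `J` derivatives, m - J, has to exceed `kernelBound J J`; the maximum
  -- with `M` lets the induction hypothesis be applied at the same `m`.
  ... | M , independent = M ℕ.⊔ (J ℕ.+ suc (kernelBound J J)) , step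
    where
    J : ℕ
    J = suc (suc k)
    step : ∀ m → M ℕ.⊔ (J ℕ.+ suc (kernelBound J J)) ≤ m → IndependentPowers J m
    step m M≤m = independentPowers-suc (m ℕ.∸ J) (ℕₚ.m+[n∸m]≡n (ℕₚ.m+n≤o⇒m≤o J J+bound≤m))
        (independent m (ℕₚ.m⊔n≤o⇒m≤o M _ M≤m))
        (ℕₚ.m+n≤o⇒m≤o∸n (suc (kernelBound J J)) (≡.subst (_≤ m) (ℕₚ.+-comm J _) J+bound≤m))
      where
      J+bound≤m : J ℕ.+ suc (kernelBound J J) ≤ m
      J+bound≤m = ℕₚ.m⊔n≤o⇒n≤o M _ M≤m

  -- Passage to the notions of the theorem

  open Polynomial rawRing using (IsScalarMultipleOf; _≈ₚ_) renaming (_^_ to _^ₚ_; sum to sumₚ)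

  ^ₚ≡^ : ∀ p m → p ^ₚ m ≡ p ^ m
  ^ₚ≡^ p zero    = ≡.refl
  ^ₚ≡^ p (suc m) = ≡.cong (p *_) (^ₚ≡^ p m)

  deg-0-scalar : ∀ {p} → Deg≤ 0 p → ∀ q → p * q ≋ coeff p 0 ·ₚ q
  deg-0-scalar {[]}    p≤0 q = ≋-sym (·-zeroˡ q)
  deg-0-scalar {_ ∷ _} p≤0 q = deg-0-* p≤0 q

  -- The zero polynomial is a scalar multiple of anything, and with two or more indices there is
  -- another polynomial to compare it with; hence no `f i` vanishes.
  nonproportional : ∀ {k} {f : Fin (suc (suc k)) → Poly} →
    (∀ i j → i ≢ j → ¬ IsScalarMultipleOf (f i) (f j)) → Nonproportional f
  nonproportional {f = f} f≁ = f≉0 , λ i j i≢j a θa≋0 fᵢ≋afⱼ → f≁ i j i≢j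
    (coeff a 0 , coeff-≈ (≋-trans fᵢ≋afⱼ (deg-0-scalar (θ≋0⇒deg-0 θa≋0) (f j))))
    where
    zero-multiple : ∀ {p} q → p ≋ 0ₚ → IsScalarMultipleOf p q
    zero-multiple q p≋0 = 0# , coeff-≈ (≋-trans p≋0 (≋-sym (·-zeroˡ q)))
    f≉0 : ∀ i → ¬ (f i ≋ 0ₚ)
    f≉0 zero    f₀≋0 = f≁ zero (suc zero) (λ ()) (zero-multiple (f (suc zero)) f₀≋0)
    f≉0 (suc i) fᵢ≋0 = f≁ (suc i) zero (λ ()) (zero-multiple (f zero) fᵢ≋0)

  sum-1*^ : ∀ {k} (f : Fin k → Poly) m → sum (λ i → (1# ∷ []) * f i ^ m) ≋ sumₚ (λ i → f i ^ₚ m)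
  sum-1*^ {k} f m = sum-cong-≋ {k} {λ i → (1# ∷ []) * f i ^ m} {λ i → f i ^ₚ m} λ i →
    ≋-trans (*-identityˡ (f i ^ m)) (Pᵣ.reflexive (≡.sym (^ₚ≡^ (f i) m)))

  independent⇒powerSum≉0 : ∀ {k} m → IndependentPowers k m → (f : Fin k → Poly) → Nonproportional f →
    Fin k → ¬ (sumₚ (λ i → f i ^ₚ m) ≈ₚ 0ₚ)
  independent⇒powerSum≉0 m independent f f≁ i relation =
    1ₚ≉0 (independent f f≁ (λ _ → 1# ∷ []) (λ _ → shift-[]) (≋-trans (sum-1*^ f m) (coeffs-≈ relation)) i)

  powerSum≉0 : ∀ k → ∃[ M ] (∀ m → M ≤ m → (f : Fin (suc (suc k)) → Poly) →
    (∀ i j → i ≢ j → ¬ IsScalarMultipleOf (f i) (f j)) → ¬ (sumₚ (λ i → f i ^ₚ m) ≈ₚ 0ₚ))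
  powerSum≉0 k = proj₁ (independentPowers (suc k)) , λ m M≤m f f≁ →
    independent⇒powerSum≉0 {suc (suc k)} m (proj₂ (independentPowers (suc k)) m M≤m) f
      (nonproportional {k} {f} f≁) zero

-- Real and complex numbers

open import Defs

-- Null sequences of rationals

Eventually : (ℕ → Set) → Set
Eventually P = ∃[ N ] (∀ n → N ≤ n → P n)

eventually-× : ∀ {P Q : ℕ → Set} → Eventually P → Eventually Q → Eventually (λ n → P n × Q n)
eventually-× (M , p) (N , q) = M ℕ.⊔ N , λ n M⊔N≤n →
  p n (ℕₚ.m⊔n≤o⇒m≤o M N M⊔N≤n) , q n (ℕₚ.m⊔n≤o⇒n≤o M N M⊔N≤n)

eventually-map : ∀ {P Q : ℕ → Set} → (∀ n → P n → Q n) → Eventually P → Eventually Q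
eventually-map f (N , p) = N , λ n N≤n → f n (p n N≤n)

Null : (ℕ → ℚ) → Set
Null s = ∀ ε → 0ℚ ℚ.< ε → Eventually (λ n → ∣ s n ∣ ℚ.< ε)

Away : (ℕ → ℚ) → Set
Away s = ∃[ δ ] (0ℚ ℚ.< δ × Eventually (λ n → δ ℚ.≤ ∣ s n ∣))

Bounded : (ℕ → ℚ) → Set
Bounded s = ∃[ b ] (0ℚ ℚ.< b × Eventually (λ n → ∣ s n ∣ ℚ.≤ b))

half>0 : ∀ {ε} → 0ℚ ℚ.< ε → 0ℚ ℚ.< ½ ℚ.* ε
half>0 = ℚₚ.*-monoʳ-<-pos ½

½ε+½ε≡ε : ∀ ε → ½ ℚ.* ε ℚ.+ ½ ℚ.* ε ≡ ε
½ε+½ε≡ε ε = ≡.trans (≡.sym (ℚₚ.*-distribʳ-+ ε ½ ½)) (ℚₚ.*-identityˡ ε)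

null-resp : ∀ {s t} → (∀ n → s n ≡ t n) → Null s → Null t
null-resp s≡t null ε ε>0 =
  eventually-map (λ n → ≡.subst (λ q → ∣ q ∣ ℚ.< ε) (s≡t n)) (null ε ε>0)

null-0 : Null (λ _ → 0ℚ)
null-0 ε ε>0 = 0 , λ _ _ → ε>0

null-+ : ∀ {s t} → Null s → Null t → Null (λ n → s n ℚ.+ t n)
null-+ {s} {t} null-s null-t ε ε>0 =
  eventually-map close (eventually-× (null-s (½ ℚ.* ε) (half>0 ε>0)) (null-t (½ ℚ.* ε) (half>0 ε>0)))
  where
  close : ∀ n → ∣ s n ∣ ℚ.< ½ ℚ.* ε × ∣ t n ∣ ℚ.< ½ ℚ.* ε → ∣ s n ℚ.+ t n ∣ ℚ.< ε
  close n (s<½ε , t<½ε) = begin-strict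
    ∣ s n ℚ.+ t n ∣          ≤⟨ ℚₚ.∣p+q∣≤∣p∣+∣q∣ (s n) (t n) ⟩
    ∣ s n ∣ ℚ.+ ∣ t n ∣      <⟨ ℚₚ.+-mono-< s<½ε t<½ε ⟩
    ½ ℚ.* ε ℚ.+ ½ ℚ.* ε      ≡⟨ ½ε+½ε≡ε ε ⟩
    ε                        ∎
    where open ℚₚ.≤-Reasoning

null-neg : ∀ {s} → Null s → Null (λ n → ℚ.- s n)
null-neg {s} null ε ε>0 =
  eventually-map (λ n → ≡.subst (ℚ._< ε) (≡.sym (ℚₚ.∣-p∣≡∣p∣ (s n)))) (null ε ε>0)

cauchy⇒bounded : ∀ {s} → IsCauchy s → Bounded s
cauchy⇒bounded {s} s-cauchy with s-cauchy 1ℚ (ℚₚ.positive⁻¹ 1ℚ)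
... | N , close =
  1ℚ ℚ.+ ∣ s N ∣ , ℚₚ.+-mono-<-≤ (ℚₚ.positive⁻¹ 1ℚ) (ℚₚ.0≤∣p∣ (s N)) , N , bound
  where
  bound : ∀ n → N ≤ n → ∣ s n ∣ ℚ.≤ 1ℚ ℚ.+ ∣ s N ∣
  bound n N≤n = begin
    ∣ s n ∣                        ≡⟨ ≡.cong ∣_∣ (solve 2 (λ p q → p := (p :- q) :+ q) ≡.refl (s n) (s N)) ⟩
    ∣ (s n ℚ.- s N) ℚ.+ s N ∣      ≤⟨ ℚₚ.∣p+q∣≤∣p∣+∣q∣ (s n ℚ.- s N) (s N) ⟩
    ∣ s n ℚ.- s N ∣ ℚ.+ ∣ s N ∣    ≤⟨ ℚₚ.+-monoˡ-≤ ∣ s N ∣ (ℚₚ.<⇒≤ (close n N N≤n ℕₚ.≤-refl)) ⟩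
    1ℚ ℚ.+ ∣ s N ∣                 ∎
    where
    open ℚₚ.≤-Reasoning
    open +-*-Solver

null-* : ∀ {s t} → Bounded s → Null t → Null (λ n → s n ℚ.* t n)
null-* {s} {t} (b , b>0 , bound) null ε ε>0 =
  eventually-map close (eventually-× bound (null (1/ b ℚ.* ε) δ>0))
  where
  instance
    b-pos : ℚ.Positive b
    b-pos = ℚ.positive b>0
    b-nonZero : ℚ.NonZero b
    b-nonZero = ℚₚ.pos⇒nonZero b
    1/b-pos : ℚ.Positive (1/ b)
    1/b-pos = ℚₚ.1/pos⇒pos b
  δ>0 : 0ℚ ℚ.< 1/ b ℚ.* ε
  δ>0 = ≡.subst (ℚ._< 1/ b ℚ.* ε) (ℚₚ.*-zeroʳ (1/ b)) (ℚₚ.*-monoʳ-<-pos (1/ b) ε>0)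
  close : ∀ n → ∣ s n ∣ ℚ.≤ b × ∣ t n ∣ ℚ.< 1/ b ℚ.* ε → ∣ s n ℚ.* t n ∣ ℚ.< ε
  close n (s≤b , t<δ) = begin-strict
    ∣ s n ℚ.* t n ∣         ≡⟨ ℚₚ.∣p*q∣≡∣p∣*∣q∣ (s n) (t n) ⟩
    ∣ s n ∣ ℚ.* ∣ t n ∣     ≤⟨ ℚₚ.*-monoʳ-≤-nonNeg ∣ t n ∣ {{ℚ.nonNegative (ℚₚ.0≤∣p∣ (t n))}} s≤b ⟩
    b ℚ.* ∣ t n ∣           <⟨ ℚₚ.*-monoʳ-<-pos b t<δ ⟩
    b ℚ.* (1/ b ℚ.* ε)      ≡⟨ ℚₚ.*-assoc b (1/ b) ε ⟨
    (b ℚ.* 1/ b) ℚ.* ε      ≡⟨ ≡.cong (ℚ._* ε) (ℚₚ.*-inverseʳ b) ⟩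
    1ℚ ℚ.* ε                ≡⟨ ℚₚ.*-identityˡ ε ⟩
    ε                       ∎
    where open ℚₚ.≤-Reasoning

-- A single late term decides: beyond `N` the terms differ by less than ε/4, so a term below ε/2
-- keeps the others below ε, and a term of at least ε/2 keeps them at ε/4 or more.
small-or-away : ∀ {s} → IsCauchy s → ∀ ε → 0ℚ ℚ.< ε →
                Eventually (λ n → ∣ s n ∣ ℚ.< ε) ⊎ Away s
small-or-away {s} s-cauchy ε ε>0 with s-cauchy (½ ℚ.* (½ ℚ.* ε)) (half>0 (half>0 ε>0))
... | N , close with ∣ s N ∣ ℚₚ.<? ½ ℚ.* ε
...   | yes sN<½ε = inj₁ (N , small)
  where
  small : ∀ n → N ≤ n → ∣ s n ∣ ℚ.< ε
  small n N≤n = begin-strict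
    ∣ s n ∣                                  ≡⟨ ≡.cong ∣_∣ (solve 2 (λ p q → p := (p :- q) :+ q) ≡.refl (s n) (s N)) ⟩
    ∣ (s n ℚ.- s N) ℚ.+ s N ∣                ≤⟨ ℚₚ.∣p+q∣≤∣p∣+∣q∣ (s n ℚ.- s N) (s N) ⟩
    ∣ s n ℚ.- s N ∣ ℚ.+ ∣ s N ∣              <⟨ ℚₚ.+-mono-< (close n N N≤n ℕₚ.≤-refl) sN<½ε ⟩
    ½ ℚ.* (½ ℚ.* ε) ℚ.+ ½ ℚ.* ε              <⟨ ℚₚ.+-monoˡ-< (½ ℚ.* ε) (p<p+p (half>0 (half>0 ε>0))) ⟩
    (δ ℚ.+ δ) ℚ.+ ½ ℚ.* ε                    ≡⟨ ≡.cong (ℚ._+ ½ ℚ.* ε) (½ε+½ε≡ε (½ ℚ.* ε)) ⟩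
    ½ ℚ.* ε ℚ.+ ½ ℚ.* ε                      ≡⟨ ½ε+½ε≡ε ε ⟩
    ε                                        ∎
    where
    open ℚₚ.≤-Reasoning
    open +-*-Solver
    δ : ℚ
    δ = ½ ℚ.* (½ ℚ.* ε)
    p<p+p : ∀ {p} → 0ℚ ℚ.< p → p ℚ.< p ℚ.+ p
    p<p+p {p} p>0 = ≡.subst (ℚ._< p ℚ.+ p) (ℚₚ.+-identityˡ p) (ℚₚ.+-monoˡ-< p p>0)
...   | no sN≮½ε = inj₂ (δ , half>0 (half>0 ε>0) , N , away)
  where
  δ : ℚ
  δ = ½ ℚ.* (½ ℚ.* ε)
  away : ∀ n → N ≤ n → δ ℚ.≤ ∣ s n ∣
  away n N≤n = ℚₚ.≮⇒≥ λ sn<δ → ℚₚ.<-irrefl ≡.refl (begin-strict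
    ½ ℚ.* ε                          ≤⟨ ℚₚ.≮⇒≥ sN≮½ε ⟩
    ∣ s N ∣                          ≡⟨ ≡.cong ∣_∣ (solve 2 (λ p q → p := (p :- q) :+ q) ≡.refl (s N) (s n)) ⟩
    ∣ (s N ℚ.- s n) ℚ.+ s n ∣        ≤⟨ ℚₚ.∣p+q∣≤∣p∣+∣q∣ (s N ℚ.- s n) (s n) ⟩
    ∣ s N ℚ.- s n ∣ ℚ.+ ∣ s n ∣      <⟨ ℚₚ.+-mono-< (close N n ℕₚ.≤-refl N≤n) sn<δ ⟩
    δ ℚ.+ δ                          ≡⟨ ½ε+½ε≡ε (½ ℚ.* ε) ⟩
    ½ ℚ.* ε                          ∎)
    where
    open ℚₚ.≤-Reasoning
    open +-*-Solver

away⇒¬null : ∀ {s} → Away s → ¬ Null s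
away⇒¬null {s} (δ , δ>0 , δ≤) null with eventually-× δ≤ (null δ δ>0)
... | N , both = ℚₚ.<-irrefl ≡.refl (ℚₚ.≤-<-trans (proj₁ (both N ℕₚ.≤-refl)) (proj₂ (both N ℕₚ.≤-refl)))

null-stable : ∀ {s} → IsCauchy s → ¬ ¬ Null s → Null s
null-stable s-cauchy ¬¬null ε ε>0 with small-or-away s-cauchy ε ε>0
... | inj₁ small = small
... | inj₂ away  = ⊥-elim (¬¬null (away⇒¬null away))

-- If being away from zero is refuted, the dichotomy leaves only smallness, for every ε. The double
-- negation remains because no ε at which smallness fails is at hand.
¬null⇒away : ∀ {s} → IsCauchy s → ¬ Null s → ¬ ¬ Away s
¬null⇒away {s} s-cauchy ¬null ¬away = ¬null null
  where
  null : Null s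
  null ε ε>0 with small-or-away s-cauchy ε ε>0
  ... | inj₁ small = small
  ... | inj₂ away  = contradiction away ¬away

-- Total, with default value 0: a sequence that is eventually bounded away from zero may still have
-- zero terms at the start.
inv : ℚ → ℚ
inv q with q ℚₚ.≟ 0ℚ
... | yes _  = 0ℚ
... | no q≢0 = 1/_ q {{ℚ.≢-nonZero q≢0}}

*-inv : ∀ q → q ≢ 0ℚ → q ℚ.* inv q ≡ 1ℚ
*-inv q q≢0 with q ℚₚ.≟ 0ℚ
... | yes q≡0 = contradiction q≡0 q≢0
... | no q≢0′ = ℚₚ.*-inverseʳ q {{ℚ.≢-nonZero q≢0′}}

∣p∣≥δ⇒p≢0 : ∀ {p δ} → 0ℚ ℚ.< δ → δ ℚ.≤ ∣ p ∣ → p ≢ 0ℚ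
∣p∣≥δ⇒p≢0 δ>0 δ≤∣p∣ ≡.refl = ℚₚ.<-irrefl ≡.refl (ℚₚ.<-≤-trans δ>0 δ≤∣p∣)

-- The difference of the inverses is (q - p)/(pq), and the absolute value of pq is at least δ²; the
-- estimate is multiplied by δ² to avoid the division.
inv-close : ∀ {p q δ ε} → 0ℚ ℚ.< δ → δ ℚ.≤ ∣ p ∣ → δ ℚ.≤ ∣ q ∣ →
            ∣ p ℚ.- q ∣ ℚ.< δ ℚ.* δ ℚ.* ε → ∣ inv p ℚ.- inv q ∣ ℚ.< ε
inv-close {p} {q} {δ} {ε} δ>0 δ≤∣p∣ δ≤∣q∣ close =
  ℚₚ.*-cancelˡ-<-nonNeg (δ ℚ.* δ) {{ℚₚ.pos⇒nonNeg (δ ℚ.* δ) {{ℚₚ.pos*pos⇒pos δ δ}}}} (begin-strict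
    δ ℚ.* δ ℚ.* ∣ d ∣                ≤⟨ ℚₚ.*-monoʳ-≤-nonNeg ∣ d ∣ δδ≤∣p∣∣q∣ ⟩
    ∣ p ∣ ℚ.* ∣ q ∣ ℚ.* ∣ d ∣        ≡⟨ ≡.cong (ℚ._* ∣ d ∣) (ℚₚ.∣p*q∣≡∣p∣*∣q∣ p q) ⟨
    ∣ p ℚ.* q ∣ ℚ.* ∣ d ∣            ≡⟨ ℚₚ.∣p*q∣≡∣p∣*∣q∣ (p ℚ.* q) d ⟨
    ∣ p ℚ.* q ℚ.* d ∣                ≡⟨ ≡.cong ∣_∣ pqd≡-[p-q] ⟩
    ∣ ℚ.- (p ℚ.- q) ∣                ≡⟨ ℚₚ.∣-p∣≡∣p∣ (p ℚ.- q) ⟩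
    ∣ p ℚ.- q ∣                      <⟨ close ⟩
    δ ℚ.* δ ℚ.* ε                    ∎)
  where
  open ℚₚ.≤-Reasoning
  open +-*-Solver
  d : ℚ
  d = inv p ℚ.- inv q
  instance
    δ-pos : ℚ.Positive δ
    δ-pos = ℚ.positive δ>0
    δ-nonNeg : ℚ.NonNegative δ
    δ-nonNeg = ℚₚ.pos⇒nonNeg δ
    d-nonNeg : ℚ.NonNegative ∣ d ∣
    d-nonNeg = ℚₚ.∣-∣-nonNeg d
    q-nonNeg : ℚ.NonNegative ∣ q ∣
    q-nonNeg = ℚₚ.∣-∣-nonNeg q
  δδ≤∣p∣∣q∣ : δ ℚ.* δ ℚ.≤ ∣ p ∣ ℚ.* ∣ q ∣
  δδ≤∣p∣∣q∣ = ℚₚ.≤-trans (ℚₚ.*-monoˡ-≤-nonNeg δ δ≤∣q∣) (ℚₚ.*-monoʳ-≤-nonNeg ∣ q ∣ δ≤∣p∣)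
  pqd≡-[p-q] : p ℚ.* q ℚ.* d ≡ ℚ.- (p ℚ.- q)
  pqd≡-[p-q] = ≡.trans
    (solve 4 (λ p q p′ q′ → p :* q :* (p′ :- q′) := q :* (p :* p′) :- p :* (q :* q′)) ≡.refl p q (inv p) (inv q))
    (≡.trans
      (≡.cong₂ (λ a b → q ℚ.* a ℚ.- p ℚ.* b) (*-inv p (∣p∣≥δ⇒p≢0 δ>0 δ≤∣p∣)) (*-inv q (∣p∣≥δ⇒p≢0 δ>0 δ≤∣q∣)))
      (solve 2 (λ p q → q :* con 1ℚ :- p :* con 1ℚ := :- (p :- q)) ≡.refl p q))

inv-cauchy : ∀ {s} → IsCauchy s → Away s → IsCauchy (λ n → inv (s n))
inv-cauchy {s} s-cauchy (δ , δ>0 , N , δ≤) ε ε>0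
  with s-cauchy (δ ℚ.* δ ℚ.* ε) (ℚₚ.positive⁻¹ (δ ℚ.* δ ℚ.* ε) {{δδε-pos}})
  where
  instance
    δ-pos : ℚ.Positive δ
    δ-pos = ℚ.positive δ>0
    ε-pos : ℚ.Positive ε
    ε-pos = ℚ.positive ε>0
  δδε-pos : ℚ.Positive (δ ℚ.* δ ℚ.* ε)
  δδε-pos = ℚₚ.pos*pos⇒pos (δ ℚ.* δ) {{ℚₚ.pos*pos⇒pos δ δ}} ε
... | M , close = N ℕ.⊔ M , λ m n N⊔M≤m N⊔M≤n →
  inv-close δ>0 (δ≤ m (ℕₚ.m⊔n≤o⇒m≤o N M N⊔M≤m)) (δ≤ n (ℕₚ.m⊔n≤o⇒m≤o N M N⊔M≤n))
    (close m n (ℕₚ.m⊔n≤o⇒n≤o N M N⊔M≤m) (ℕₚ.m⊔n≤o⇒n≤o N M N⊔M≤n))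

-- Arithmetic of the real numbers

≗⇒≈ℝ : ∀ {x y} → (∀ n → seq x n ≡ seq y n) → x ≈ℝ y
≗⇒≈ℝ {x} {y} x≗y = null-resp
  (λ n → ≡.trans (≡.sym (ℚₚ.+-inverseʳ (seq y n))) (≡.cong (ℚ._- seq y n) (≡.sym (x≗y n)))) null-0

≈ℝ-sym : ∀ {x y} → x ≈ℝ y → y ≈ℝ x
≈ℝ-sym {x} {y} x≈y = null-resp
  (λ n → solve 2 (λ p q → :- (p :- q) := q :- p) ≡.refl (seq x n) (seq y n)) (null-neg x≈y)
  where open +-*-Solver

≈ℝ-trans : ∀ {x y z} → x ≈ℝ y → y ≈ℝ z → x ≈ℝ z
≈ℝ-trans {x} {y} {z} x≈y y≈z = null-resp
  (λ n → solve 3 (λ p q r → (p :- q) :+ (q :- r) := p :- r) ≡.refl (seq x n) (seq y n) (seq z n))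
  (null-+ x≈y y≈z)
  where open +-*-Solver

+ℝ-cong : ∀ {x x′ y y′} → x ≈ℝ x′ → y ≈ℝ y′ → x +ℝ y ≈ℝ x′ +ℝ y′
+ℝ-cong {x} {x′} {y} {y′} x≈x′ y≈y′ = null-resp
  (λ n → solve 4 (λ p p′ q q′ → (p :- p′) :+ (q :- q′) := (p :+ q) :- (p′ :+ q′)) ≡.refl
    (seq x n) (seq x′ n) (seq y n) (seq y′ n))
  (null-+ x≈x′ y≈y′)
  where open +-*-Solver

-ℝ-cong : ∀ {x x′} → x ≈ℝ x′ → -ℝ x ≈ℝ -ℝ x′
-ℝ-cong {x} {x′} x≈x′ = null-resp
  (λ n → solve 2 (λ p p′ → :- (p :- p′) := (:- p) :- (:- p′)) ≡.refl (seq x n) (seq x′ n))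
  (null-neg x≈x′)
  where open +-*-Solver

*ℝ-cong : ∀ {x x′ y y′} → x ≈ℝ x′ → y ≈ℝ y′ → x *ℝ y ≈ℝ x′ *ℝ y′
*ℝ-cong {x} {x′} {y} {y′} x≈x′ y≈y′ = null-resp
  (λ n → solve 4 (λ p p′ q q′ → p :* (q :- q′) :+ q′ :* (p :- p′) := p :* q :- p′ :* q′) ≡.refl
    (seq x n) (seq x′ n) (seq y n) (seq y′ n))
  (null-+ {λ n → seq x n ℚ.* (seq y n ℚ.- seq y′ n)} {λ n → seq y′ n ℚ.* (seq x n ℚ.- seq x′ n)}
    (null-* {seq x} (cauchy⇒bounded (cauchy x)) y≈y′)
    (null-* {seq y′} (cauchy⇒bounded (cauchy y′)) x≈x′))
  where open +-*-Solver

≈ℝ-stable : ∀ {x y} → ¬ ¬ (x ≈ℝ y) → x ≈ℝ y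
≈ℝ-stable {x} {y} = null-stable (cauchy (x -ℝ y))

0ℝ 1ℝ : ℝ
0ℝ = fromℚ 0ℚ
1ℝ = fromℚ 1ℚ

ℝ-inverse : ∀ {x} → ¬ (x ≈ℝ 0ℝ) → ¬ ¬ (∃[ y ] (x *ℝ y ≈ℝ 1ℝ))
ℝ-inverse {x} x≉0 = ¬¬-map inverse (¬null⇒away (cauchy x) (λ null → x≉0 (null-resp x≡x-0 null)))
  where
  x≡x-0 : ∀ n → seq x n ≡ seq x n ℚ.- 0ℚ
  x≡x-0 n = ≡.sym (ℚₚ.+-identityʳ (seq x n))
  inverse : Away (seq x) → ∃[ y ] (x *ℝ y ≈ℝ 1ℝ)
  inverse away@(δ , δ>0 , δ≤) =
    mkℝ (λ n → inv (seq x n)) (inv-cauchy (cauchy x) away) ,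
    λ ε ε>0 → eventually-map
      (λ n δ≤∣xn∣ → ≡.subst (ℚ._< ε)
        (≡.cong (λ q → ∣ q ℚ.- 1ℚ ∣) (≡.sym (*-inv (seq x n) (∣p∣≥δ⇒p≢0 δ>0 δ≤∣xn∣)))) ε>0)
      δ≤

-- Termwise x² is at most x² + y², so closeness of the sum to 0 within ε² bounds x by ε.
x²+y²≈0⇒x≈0 : ∀ {x y} → x *ℝ x +ℝ y *ℝ y ≈ℝ 0ℝ → x ≈ℝ 0ℝ
x²+y²≈0⇒x≈0 {x} {y} x²+y²≈0 ε ε>0 = eventually-map small (x²+y²≈0 (ε ℚ.* ε) ε²>0)
  where
  instance
    ε-pos : ℚ.Positive ε
    ε-pos = ℚ.positive ε>0
    ε-nonNeg : ℚ.NonNegative ε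
    ε-nonNeg = ℚₚ.pos⇒nonNeg ε
  ε²>0 : 0ℚ ℚ.< ε ℚ.* ε
  ε²>0 = ℚₚ.positive⁻¹ (ε ℚ.* ε) {{ℚₚ.pos*pos⇒pos ε ε}}
  square : ∀ p → p ℚ.* p ≡ ∣ p ∣ ℚ.* ∣ p ∣
  square p with ℚₚ.∣p∣≡p∨∣p∣≡-p p
  ... | inj₁ ∣p∣≡p  = ≡.sym (≡.cong₂ ℚ._*_ ∣p∣≡p ∣p∣≡p)
  ... | inj₂ ∣p∣≡-p = ≡.trans (solve 1 (λ p → p :* p := (:- p) :* (:- p)) ≡.refl p)
                        (≡.sym (≡.cong₂ ℚ._*_ ∣p∣≡-p ∣p∣≡-p))
    where open +-*-Solver
  p²≥0 : ∀ p → 0ℚ ℚ.≤ p ℚ.* p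
  p²≥0 p = ≡.subst (0ℚ ℚ.≤_) (≡.trans (ℚₚ.∣p*q∣≡∣p∣*∣q∣ p p) (≡.sym (square p))) (ℚₚ.0≤∣p∣ (p ℚ.* p))
  small : ∀ n → ∣ (seq x n ℚ.* seq x n ℚ.+ seq y n ℚ.* seq y n) ℚ.- 0ℚ ∣ ℚ.< ε ℚ.* ε →
          ∣ seq x n ℚ.- 0ℚ ∣ ℚ.< ε
  small n sum<ε² = ≡.subst (λ q → ∣ q ∣ ℚ.< ε) (≡.sym (ℚₚ.+-identityʳ p)) (ℚₚ.≰⇒> λ ε≤∣p∣ →
    ℚₚ.<-irrefl ≡.refl (begin-strict
      ε ℚ.* ε                              ≤⟨ ℚₚ.*-monoˡ-≤-nonNeg ε ε≤∣p∣ ⟩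
      ε ℚ.* ∣ p ∣                          ≤⟨ ℚₚ.*-monoʳ-≤-nonNeg ∣ p ∣ {{ℚₚ.∣-∣-nonNeg p}} ε≤∣p∣ ⟩
      ∣ p ∣ ℚ.* ∣ p ∣                      ≡⟨ square p ⟨
      p ℚ.* p                              ≡⟨ ℚₚ.+-identityʳ (p ℚ.* p) ⟨
      p ℚ.* p ℚ.+ 0ℚ                       ≤⟨ ℚₚ.+-monoʳ-≤ (p ℚ.* p) (p²≥0 q) ⟩
      p ℚ.* p ℚ.+ q ℚ.* q                  ≡⟨ ℚₚ.0≤p⇒∣p∣≡p (ℚₚ.+-mono-≤ (p²≥0 p) (p²≥0 q)) ⟨
      ∣ p ℚ.* p ℚ.+ q ℚ.* q ∣              ≡⟨ ≡.cong ∣_∣ (ℚₚ.+-identityʳ (p ℚ.* p ℚ.+ q ℚ.* q)) ⟨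
      ∣ (p ℚ.* p ℚ.+ q ℚ.* q) ℚ.- 0ℚ ∣     <⟨ sum<ε² ⟩
      ε ℚ.* ε                              ∎))
    where
    open ℚₚ.≤-Reasoning
    p q : ℚ
    p = seq x n
    q = seq y n

-- The field of complex numbers

private
  module ℂᵣ = RawRing ℂ-rawRing

-- The ring laws hold for the rational sequences term by term, which reduces each of them to
-- identities between rational polynomials.
≗⇒≈ℂ : ∀ z w → (∀ n → seq (re z) n ≡ seq (re w) n) → (∀ n → seq (im z) n ≡ seq (im w) n) → z ℂᵣ.≈ w
≗⇒≈ℂ z w re≗ im≗ = ≗⇒≈ℝ {re z} {re w} re≗ , ≗⇒≈ℝ {im z} {im w} im≗

≈ℂ-refl : ∀ {z} → z ℂᵣ.≈ z
≈ℂ-refl {z} = ≗⇒≈ℂ z z (λ _ → ≡.refl) (λ _ → ≡.refl)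

*ℂ-cong : ∀ {z z′ w w′} → z ℂᵣ.≈ z′ → w ℂᵣ.≈ w′ → z ℂᵣ.* w ℂᵣ.≈ z′ ℂᵣ.* w′
*ℂ-cong {a +i b} {a′ +i b′} {c +i d} {c′ +i d′} (a≈ , b≈) (c≈ , d≈) =
  +ℝ-cong {a *ℝ c} {a′ *ℝ c′} { -ℝ (b *ℝ d)} { -ℝ (b′ *ℝ d′)} (*ℝ-cong {a} {a′} {c} {c′} a≈ c≈)
    (-ℝ-cong {b *ℝ d} {b′ *ℝ d′} (*ℝ-cong {b} {b′} {d} {d′} b≈ d≈)) ,
  +ℝ-cong {a *ℝ d} {a′ *ℝ d′} {b *ℝ c} {b′ *ℝ c′} (*ℝ-cong {a} {a′} {d} {d′} a≈ d≈)
    (*ℝ-cong {b} {b′} {c} {c′} b≈ c≈)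

ℂ-commutativeRing : CommutativeRing 0ℓ 0ℓ
ℂ-commutativeRing = record
  { Carrier = ℂ
  ; _≈_ = ℂᵣ._≈_
  ; _+_ = ℂᵣ._+_
  ; _*_ = ℂᵣ._*_
  ; -_ = ℂᵣ.-_
  ; 0# = ℂᵣ.0#
  ; 1# = ℂᵣ.1#
  ; isCommutativeRing = record
    { isRing = record
      { +-isAbelianGroup = record
        { isGroup = record
          { isMonoid = record
            { isSemigroup = record
              { isMagma = record
                { isEquivalence = record
                  { refl = λ {z} → ≈ℂ-refl {z}
                  ; sym = λ {z} {w} (p , q) → ≈ℝ-sym {re z} {re w} p , ≈ℝ-sym {im z} {im w} q
                  ; trans = λ {u} {v} {w} (p , q) (p′ , q′) →
                      ≈ℝ-trans {re u} {re v} {re w} p p′ , ≈ℝ-trans {im u} {im v} {im w} q q′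
                  }
                ; ∙-cong = λ {u} {v} {z} {w} (p , q) (p′ , q′) →
                    +ℝ-cong {re u} {re v} {re z} {re w} p p′ , +ℝ-cong {im u} {im v} {im z} {im w} q q′
                }
              ; assoc = λ u v w → ≗⇒≈ℂ (u ℂᵣ.+ v ℂᵣ.+ w) (u ℂᵣ.+ (v ℂᵣ.+ w))
                  (λ n → ℚₚ.+-assoc (seq (re u) n) (seq (re v) n) (seq (re w) n))
                  (λ n → ℚₚ.+-assoc (seq (im u) n) (seq (im v) n) (seq (im w) n))
              }
            ; identity =
                (λ z → ≗⇒≈ℂ (ℂᵣ.0# ℂᵣ.+ z) z
                  (λ n → ℚₚ.+-identityˡ (seq (re z) n)) (λ n → ℚₚ.+-identityˡ (seq (im z) n))) ,
                (λ z → ≗⇒≈ℂ (z ℂᵣ.+ ℂᵣ.0#) z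
                  (λ n → ℚₚ.+-identityʳ (seq (re z) n)) (λ n → ℚₚ.+-identityʳ (seq (im z) n)))
            }
          ; inverse =
              (λ z → ≗⇒≈ℂ (ℂᵣ.- z ℂᵣ.+ z) ℂᵣ.0#
                (λ n → ℚₚ.+-inverseˡ (seq (re z) n)) (λ n → ℚₚ.+-inverseˡ (seq (im z) n))) ,
              (λ z → ≗⇒≈ℂ (z ℂᵣ.+ ℂᵣ.- z) ℂᵣ.0#
                (λ n → ℚₚ.+-inverseʳ (seq (re z) n)) (λ n → ℚₚ.+-inverseʳ (seq (im z) n)))
          ; ⁻¹-cong = λ {z} {w} (p , q) → -ℝ-cong {re z} {re w} p , -ℝ-cong {im z} {im w} q
          }
        ; comm = λ z w → ≗⇒≈ℂ (z ℂᵣ.+ w) (w ℂᵣ.+ z)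
            (λ n → ℚₚ.+-comm (seq (re z) n) (seq (re w) n))
            (λ n → ℚₚ.+-comm (seq (im z) n) (seq (im w) n))
        }
      ; *-cong = λ {u} {v} {z} {w} → *ℂ-cong {u} {v} {z} {w}
      ; *-assoc = λ u v w → ≗⇒≈ℂ ((u ℂᵣ.* v) ℂᵣ.* w) (u ℂᵣ.* (v ℂᵣ.* w))
          (λ n → solve 6 (λ a b c d e f →
              (a :* c :- b :* d) :* e :- (a :* d :+ b :* c) :* f
                := a :* (c :* e :- d :* f) :- b :* (c :* f :+ d :* e)) ≡.refl
            (seq (re u) n) (seq (im u) n) (seq (re v) n) (seq (im v) n) (seq (re w) n) (seq (im w) n))
          (λ n → solve 6 (λ a b c d e f →
              (a :* c :- b :* d) :* f :+ (a :* d :+ b :* c) :* e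
                := a :* (c :* f :+ d :* e) :+ b :* (c :* e :- d :* f)) ≡.refl
            (seq (re u) n) (seq (im u) n) (seq (re v) n) (seq (im v) n) (seq (re w) n) (seq (im w) n))
      ; *-identity =
          (λ z → ≗⇒≈ℂ (ℂᵣ.1# ℂᵣ.* z) z
            (λ n → solve 2 (λ a b → con 1ℚ :* a :- con 0ℚ :* b := a) ≡.refl (seq (re z) n) (seq (im z) n))
            (λ n → solve 2 (λ a b → con 1ℚ :* b :+ con 0ℚ :* a := b) ≡.refl (seq (re z) n) (seq (im z) n))) ,
          (λ z → ≗⇒≈ℂ (z ℂᵣ.* ℂᵣ.1#) z
            (λ n → solve 2 (λ a b → a :* con 1ℚ :- b :* con 0ℚ := a) ≡.refl (seq (re z) n) (seq (im z) n))
            (λ n → solve 2 (λ a b → a :* con 0ℚ :+ b :* con 1ℚ := b) ≡.refl (seq (re z) n) (seq (im z) n)))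
      ; distrib =
          (λ u v w → ≗⇒≈ℂ (u ℂᵣ.* (v ℂᵣ.+ w)) (u ℂᵣ.* v ℂᵣ.+ u ℂᵣ.* w)
            (λ n → solve 6 (λ a b c d e f →
                a :* (c :+ e) :- b :* (d :+ f) := (a :* c :- b :* d) :+ (a :* e :- b :* f)) ≡.refl
              (seq (re u) n) (seq (im u) n) (seq (re v) n) (seq (im v) n) (seq (re w) n) (seq (im w) n))
            (λ n → solve 6 (λ a b c d e f →
                a :* (d :+ f) :+ b :* (c :+ e) := (a :* d :+ b :* c) :+ (a :* f :+ b :* e)) ≡.refl
              (seq (re u) n) (seq (im u) n) (seq (re v) n) (seq (im v) n) (seq (re w) n) (seq (im w) n))) ,
          (λ u v w → ≗⇒≈ℂ ((v ℂᵣ.+ w) ℂᵣ.* u) (v ℂᵣ.* u ℂᵣ.+ w ℂᵣ.* u)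
            (λ n → solve 6 (λ a b c d e f →
                (c :+ e) :* a :- (d :+ f) :* b := (c :* a :- d :* b) :+ (e :* a :- f :* b)) ≡.refl
              (seq (re u) n) (seq (im u) n) (seq (re v) n) (seq (im v) n) (seq (re w) n) (seq (im w) n))
            (λ n → solve 6 (λ a b c d e f →
                (c :+ e) :* b :+ (d :+ f) :* a := (c :* b :+ d :* a) :+ (e :* b :+ f :* a)) ≡.refl
              (seq (re u) n) (seq (im u) n) (seq (re v) n) (seq (im v) n) (seq (re w) n) (seq (im w) n)))
      }
    ; *-comm = λ z w → ≗⇒≈ℂ (z ℂᵣ.* w) (w ℂᵣ.* z)
        (λ n → solve 4 (λ a b c d → a :* c :- b :* d := c :* a :- d :* b) ≡.refl
          (seq (re z) n) (seq (im z) n) (seq (re w) n) (seq (im w) n))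
        (λ n → solve 4 (λ a b c d → a :* d :+ b :* c := c :* b :+ d :* a) ≡.refl
          (seq (re z) n) (seq (im z) n) (seq (re w) n) (seq (im w) n))
    }
  }
  where open +-*-Solver

≈ℂ-stable : ∀ {z w} → ¬ ¬ (z ℂᵣ.≈ w) → z ℂᵣ.≈ w
≈ℂ-stable {z} {w} ¬¬z≈w =
  ≈ℝ-stable {re z} {re w} (¬¬-map proj₁ ¬¬z≈w) , ≈ℝ-stable {im z} {im w} (¬¬-map proj₂ ¬¬z≈w)

ℂ-1≉0 : ¬ (ℂᵣ.1# ℂᵣ.≈ ℂᵣ.0#)
ℂ-1≉0 (1≈0 , _) = away⇒¬null {λ _ → 1ℚ} (1ℚ , ℚₚ.positive⁻¹ 1ℚ , 0 , λ _ _ → ℚₚ.≤-refl) 1≈0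

-- The inverse is the conjugate divided by a² + b², which vanishes only when both parts do.
ℂ-inverse : ∀ {z} → ¬ (z ℂᵣ.≈ ℂᵣ.0#) → ¬ ¬ (∃[ w ] z ℂᵣ.* w ℂᵣ.≈ ℂᵣ.1#)
ℂ-inverse {a +i b} z≉0 = ¬¬-map conjugate/norm (ℝ-inverse {norm} norm≉0)
  where
  open +-*-Solver
  norm : ℝ
  norm = a *ℝ a +ℝ b *ℝ b
  norm≉0 : ¬ (norm ≈ℝ 0ℝ)
  norm≉0 norm≈0 = z≉0 (x²+y²≈0⇒x≈0 {a} {b} norm≈0 ,
    x²+y²≈0⇒x≈0 {b} {a} (≈ℝ-trans {b *ℝ b +ℝ a *ℝ a} {norm} {0ℝ}
      (≗⇒≈ℝ {b *ℝ b +ℝ a *ℝ a} {norm} (λ n → ℚₚ.+-comm (seq (b *ℝ b) n) (seq (a *ℝ a) n))) norm≈0))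
  conjugate/norm : ∃[ r ] (norm *ℝ r ≈ℝ 1ℝ) → ∃[ w ] (a +i b) ℂᵣ.* w ℂᵣ.≈ ℂᵣ.1#
  conjugate/norm (r , norm*r≈1) = w ,
    ≈ℝ-trans {re ((a +i b) ℂᵣ.* w)} {norm *ℝ r} {1ℝ}
      (≗⇒≈ℝ {re ((a +i b) ℂᵣ.* w)} {norm *ℝ r} (λ n →
        solve 3 (λ a b r → a :* (a :* r) :- b :* (:- b :* r) := (a :* a :+ b :* b) :* r) ≡.refl
          (seq a n) (seq b n) (seq r n)))
      norm*r≈1 ,
    ≗⇒≈ℝ {im ((a +i b) ℂᵣ.* w)} {0ℝ} (λ n →
      solve 3 (λ a b r → a :* (:- b :* r) :+ b :* (a :* r) := con 0ℚ) ≡.refl (seq a n) (seq b n) (seq r n))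
    where
    w : ℂ
    w = a *ℝ r +i (-ℝ b) *ℝ r

-- Characteristic zero

private
  module ℚ× = RawMonoidDefinitions ℚ.+-0-rawMonoid
  open RawMonoidDefinitions (RawRing.+-rawMonoid ℂ-rawRing) using () renaming (_×_ to _×ℂ_)

×-seq-re : ∀ n z i → seq (re (n ×ℂ z)) i ≡ n ℚ×.× seq (re z) i
×-seq-re zero    z i = ≡.refl
×-seq-re (suc n) z i = ≡.cong (seq (re z) i ℚ.+_) (×-seq-re n z i)

×-seq-im : ∀ n z i → seq (im (n ×ℂ z)) i ≡ n ℚ×.× seq (im z) i
×-seq-im zero    z i = ≡.refl
×-seq-im (suc n) z i = ≡.cong (seq (im z) i ℚ.+_) (×-seq-im n z i)

∣p∣≤∣1+n×p∣ : ∀ n p → ∣ p ∣ ℚ.≤ ∣ suc n ℚ×.× p ∣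
∣p∣≤∣1+n×p∣ n p = begin
  ∣ p ∣                         ≡⟨ ℚₚ.*-identityˡ ∣ p ∣ ⟨
  1ℚ ℚ.* ∣ p ∣                  ≤⟨ ℚₚ.*-monoʳ-≤-nonNeg ∣ p ∣ {{ℚₚ.∣-∣-nonNeg p}} 1≤1+n ⟩
  (suc n ℚ×.× 1ℚ) ℚ.* ∣ p ∣     ≡⟨ ≡.cong (ℚ._* ∣ p ∣) (ℚₚ.0≤p⇒∣p∣≡p (0≤n (suc n))) ⟨
  ∣ suc n ℚ×.× 1ℚ ∣ ℚ.* ∣ p ∣   ≡⟨ ℚₚ.∣p*q∣≡∣p∣*∣q∣ (suc n ℚ×.× 1ℚ) p ⟨
  ∣ (suc n ℚ×.× 1ℚ) ℚ.* p ∣     ≡⟨ ≡.cong ∣_∣ (n×1*p (suc n)) ⟩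
  ∣ suc n ℚ×.× p ∣              ∎
  where
  open ℚₚ.≤-Reasoning
  0≤n : ∀ n → 0ℚ ℚ.≤ n ℚ×.× 1ℚ
  0≤n zero    = ℚₚ.≤-refl
  0≤n (suc n) = ℚₚ.+-mono-≤ (ℚₚ.nonNegative⁻¹ 1ℚ) (0≤n n)
  1≤1+n : 1ℚ ℚ.≤ 1ℚ ℚ.+ n ℚ×.× 1ℚ
  1≤1+n = ≡.subst (ℚ._≤ 1ℚ ℚ.+ n ℚ×.× 1ℚ) (ℚₚ.+-identityʳ 1ℚ) (ℚₚ.+-monoʳ-≤ 1ℚ (0≤n n))
  n×1*p : ∀ n → (n ℚ×.× 1ℚ) ℚ.* p ≡ n ℚ×.× p
  n×1*p zero    = ℚₚ.*-zeroˡ p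
  n×1*p (suc n) = ≡.trans (ℚₚ.*-distribʳ-+ p 1ℚ (n ℚ×.× 1ℚ)) (≡.cong₂ ℚ._+_ (ℚₚ.*-identityˡ p) (n×1*p n))

null-×⁻¹ : ∀ {s} n → Null (λ i → suc n ℚ×.× s i) → Null s
null-×⁻¹ {s} n null ε ε>0 =
  eventually-map (λ i → ℚₚ.≤-<-trans (∣p∣≤∣1+n×p∣ n (s i))) (null ε ε>0)

-- No division is made: a rational is at most its multiple by `suc n` in absolute value, so nullity
-- of the multiples passes to the sequence itself.
ℂ-char0 : ∀ n {z} → suc n ×ℂ z ℂᵣ.≈ ℂᵣ.0# → z ℂᵣ.≈ ℂᵣ.0#
ℂ-char0 n {z} (re≈0 , im≈0) = descend {re (suc n ×ℂ z)} {re z} (×-seq-re (suc n) z) re≈0 ,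
                              descend {im (suc n ×ℂ z)} {im z} (×-seq-im (suc n) z) im≈0
  where
  descend : ∀ {x y} → (∀ i → seq x i ≡ suc n ℚ×.× seq y i) → x ≈ℝ 0ℝ → y ≈ℝ 0ℝ
  descend {x} {y} x≗ny x≈0 = null-resp (λ i → ≡.sym (ℚₚ.+-identityʳ (seq y i)))
    (null-×⁻¹ n (null-resp (λ i → ≡.trans (ℚₚ.+-identityʳ (seq x i)) (x≗ny i)) x≈0))

ℂ-stableField : StableField ℂ-commutativeRing
ℂ-stableField = record
  { stable  = λ {z} {w} → ≈ℂ-stable {z} {w}
  ; inverse = λ {z} → ℂ-inverse {z}
  ; char0   = λ n {z} → ℂ-char0 n {z}
  ; 1≉0     = ℂ-1≉0
  }

theorem4 : ∀ (k : ℕ) → 2 ≤ k →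
    ∃[ M ] ∀ (m : ℕ) → M ≤ m →
    ¬ (Σ[ f ∈ (Fin k → ℂ[x]) ]
    (∀ i j → i ≢ j → ¬ (IsScalarMultipleOf (f i) (f j)))
    × sum (λ i → f i ^ m) ≈ₚ 0ₚ)
theorem4 (suc (suc k)) (s≤s (s≤s z≤n)) =
  proj₁ bound , λ m M≤m (f , f≁ , relation) → proj₂ bound m M≤m f f≁ relation
  where
  bound = PowerSums.powerSum≉0 ℂ-commutativeRing ℂ-stableField k
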